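{- Let $G=(P,B)$ be an irreducible braced triangulation with $b=|B|\geq 2$. Then $|V(P)|\leq 4b^2-2b$.
   Context: A sphere graph is a simple graph with a fixed embedding in the 2-sphere without edge crossings. A (sphere) triangulation $P$ is a maximal sphere graph with at least 3 vertices. An edge $e$ of $P$ is contractible in $P$ if it belongs to precisely two 3-cycles of $P$. A braced triangulation $G=(P,B)$ is the simple graph obtained from a triangulation $P$ by adjoining a set $B$ of additional edges (braces) joining pairs of vertices non-adjacent in $P$. An edge $e$ of $P$ is contractible in $G$ if $e$ is contractible in $P$ and $e$ does not belong to any 3-cycle of $G$ containing a brace. $G$ is irreducible if no edge of $P$ is contractible in $G$. -}

module Defs where

open import Data.Nat using (ℕ; zero; suc; _+_; _*_; _≤_; _/_)
open import Data.Fin using (Fin)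
open import Data.Product using (_×_; _,_; ∃; ∃-syntax; proj₁; proj₂)
open import Data.Sum using (_⊎_)
open import Relation.Binary.PropositionalEquality using (_≡_; _≢_)
open import Relation.Nullary using (¬_)

iter : {A : Set} → (A → A) → ℕ → A → A
iter f zero x = x
iter f (suc k) x = f (iter f k x)

-- Reachability of darts under the group generated by σ and α
-- (σ is a permutation of a finite set, so forward steps suffice).
data Reach {d : ℕ} (σ α : Fin d → Fin d) (x : Fin d) : Fin d → Set where
  here  : Reach σ α x x
  stepσ : ∀ {y} → Reach σ α x y → Reach σ α x (σ y)
  stepα : ∀ {y} → Reach σ α x y → Reach σ α x (α y)

-- A sphere triangulation on the vertex set Fin n, given as a combinatorial
-- map (rotation system): darts Fin d with d = 2·m (m = number of edges),
-- α = fixed-point-free involution pairing the two darts of an edge,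
-- σ = rotation (cyclic order of darts around each vertex),
-- faces = orbits of φ = σ ∘ α.  The map is connected, has Euler
-- characteristic 2 (so it is an embedding in the 2-sphere), every face
-- is a triangle, and the underlying graph is simple with ≥ 3 vertices.
record SphereTriangulation (n : ℕ) : Set where
  field
    m      : ℕ
    d      : ℕ
    d≡2m   : d ≡ 2 * m
    vert   : Fin d → Fin n
    α      : Fin d → Fin d
    σ      : Fin d → Fin d
    σ⁻¹    : Fin d → Fin d
    α-invol : ∀ x → α (α x) ≡ x
    α-fpf   : ∀ x → α x ≢ x
    σσ⁻¹    : ∀ x → σ (σ⁻¹ x) ≡ x
    σ⁻¹σ    : ∀ x → σ⁻¹ (σ x) ≡ x
    vert-σ     : ∀ x → vert (σ x) ≡ vert x
    vert-orbit : ∀ x y → vert x ≡ vert y → ∃[ k ] iter σ k x ≡ y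
    vert-surj  : ∀ (v : Fin n) → ∃[ x ] vert x ≡ v
    connected  : ∀ x y → Reach σ α x y
    face-tri₁  : ∀ x → σ (α x) ≢ x
    face-tri₃  : ∀ x → σ (α (σ (α (σ (α x))))) ≡ x
    -- Euler's formula V - E + F = 2, F = number of faces = d / 3
    euler      : n + d / 3 ≡ m + 2
    no-loop    : ∀ x → vert (α x) ≢ vert x
    no-multi   : ∀ x y → vert x ≡ vert y → vert (α x) ≡ vert (α y) → x ≡ y
    three≤n    : 3 ≤ n

module _ {n : ℕ} (P : SphereTriangulation n) where
  open SphereTriangulation P

  Adj : Fin n → Fin n → Set
  Adj u v = ∃[ x ] (vert x ≡ u × vert (α x) ≡ v)

  CommonNbr : Fin n → Fin n → Fin n → Set
  CommonNbr u v w = w ≢ u × w ≢ v × Adj u w × Adj v w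

  ContractibleInP : Fin n → Fin n → Set
  ContractibleInP u v =
    ∃[ w₁ ] ∃[ w₂ ] (w₁ ≢ w₂ × CommonNbr u v w₁ × CommonNbr u v w₂ ×
      (∀ w → CommonNbr u v w → w ≡ w₁ ⊎ w ≡ w₂))

  record Braces (b : ℕ) : Set where
    field
      brace      : Fin b → Fin n × Fin n
      brace-ne   : ∀ i → proj₁ (brace i) ≢ proj₂ (brace i)
      brace-nadj : ∀ i → ¬ Adj (proj₁ (brace i)) (proj₂ (brace i))
      brace-inj  : ∀ i j → (brace i ≡ brace j ⊎
                              brace i ≡ (proj₂ (brace j) , proj₁ (brace j))) → i ≡ j

  module _ {b : ℕ} (B : Braces b) where
    open Braces B

    IsBrace : Fin n → Fin n → Set
    IsBrace u v = ∃[ i ] (brace i ≡ (u , v) ⊎ brace i ≡ (v , u))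

    AdjG : Fin n → Fin n → Set
    AdjG u v = Adj u v ⊎ IsBrace u v

    InBracedTriangle : Fin n → Fin n → Set
    InBracedTriangle u v =
      ∃[ w ] (w ≢ u × w ≢ v × AdjG u w × AdjG v w ×
              (IsBrace u v ⊎ IsBrace u w ⊎ IsBrace v w))

    ContractibleInG : Fin n → Fin n → Set
    ContractibleInG u v = ContractibleInP u v × ¬ InBracedTriangle u v

    Irreducible : Set
    Irreducible = ∀ u v → Adj u v → ¬ ContractibleInG u v

module Submission where

-- A vertex v that is not a brace end is adjacent to both ends of some brace. Otherwise every
-- edge v u lies on a nonfacial 3-cycle, so every vertex of the link of v lies on a chord of the
-- link, which is impossible as chords do not cross.
--
-- For a brace x y let K be the set of common neighbours of x and y that are not brace ends, cut
-- by the 4-cycles x κ y κ′ into |K| regions. If |K| ≥ 4, every region contains a brace end: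
-- otherwise by the first step it has no interior vertex, so it consists of two faces sharing an
-- edge κ κ′, which then lies on a nonfacial 3-cycle separating x from y, contradicting the path
-- through a fourth element of K. Hence |K| ≤ max(3, 2b) ≤ 4b − 4 and n ≤ 2b + b (4b − 4).
--
-- The Jordan curve theorem enters as a colouring of the faces whose value changes exactly across
-- the edges of a given cycle. It solves a linear system over ℤ which, by Euler's formula, has
-- more unknowns than equations.

open import Defs
open import Data.Bool using (true; false; if_then_else_)
open import Data.Nat using (ℕ; zero; suc; z≤n; s≤s; _≤_; _<_; _∸_)
import Data.Nat as ℕ
import Data.Nat.DivMod as ℕ
import Data.Nat.Properties as ℕ
import Data.Nat.Tactic.RingSolver as ℕSolver
open import Data.Integer using (ℤ; +_; -[1+_]; 0ℤ; 1ℤ; _+_; _*_; -_; _-_)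
import Data.Integer.Properties as ℤ
open import Data.Integer.Tactic.RingSolver using (solve-∀)
open import Data.Fin using (Fin; zero; suc; _↑ˡ_; _↑ʳ_)
import Data.Fin as Fin
import Data.Fin.Properties as Fin
open import Data.Fin.Permutation using (Permutation; permutation)
open import Data.List using (List; []; _∷_; length; map; filter; tabulate; allFin; concat; lookup; _++_)
import Data.List.Properties as List
open import Data.List.Membership.Propositional using (_∈_; find)
open import Data.List.Membership.Propositional.Properties
open import Data.List.Relation.Binary.Permutation.Propositional using (↭-sym; ↭-reflexive; ↭-trans)
open import Data.List.Relation.Binary.Permutation.Propositional.Properties using (shift; All-resp-↭; ↭-length)
open import Data.List.Relation.Unary.All as All using (All; []; _∷_)
import Data.List.Relation.Unary.All.Properties as All
open import Data.List.Relation.Unary.Any using (any?; index)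
open import Data.List.Relation.Unary.Any.Properties using (lookup-index)
open import Data.List.Relation.Unary.Unique.Propositional using (Unique; _∷_)
import Data.List.Relation.Unary.Unique.Propositional.Properties as Unique
open import Data.Product using (_×_; _,_; ∃; proj₁; proj₂)
open import Data.Sum using (_⊎_; inj₁; inj₂; [_,_]′)
import Data.Vec.Functional as Vector
open import Data.Empty using (⊥; ⊥-elim)
open import Function using (_∘_; id)
open import Relation.Binary.Definitions using (tri<; tri≈; tri>)
open import Relation.Binary.PropositionalEquality
open import Relation.Nullary using (¬_; Dec; yes; no; does; contradiction)
open import Relation.Nullary.Decidable using (¬?; _×-dec_; _⊎-dec_; decidable-stable; dec-true; dec-false)
open import Relation.Unary using (Decidable)
import Algebra.Construct.NaturalChoice.Min as Min
import Algebra.Properties.Semiring.Sum as Sum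

-- Homogeneous linear systems over ℤ

Functional : ℕ → Set
Functional N = (Fin N → ℤ) → ℤ

-- Quantifying over every `w` pointwise equal to the combination makes a linear `E` respect
-- pointwise equality of vectors as well.
IsLinear : ∀ {N} → Functional N → Set
IsLinear E = ∀ r s u v w → (∀ i → w i ≡ r * u i + s * v i) → E w ≡ r * E u + s * E v

coordinate-linear : ∀ {N} (i : Fin N) → IsLinear (λ v → v i)
coordinate-linear i _ _ _ _ _ w≡ = w≡ i

plus-linear : ∀ {N} {E F : Functional N} → IsLinear E → IsLinear F → IsLinear (λ v → E v + F v)
plus-linear {E = E} {F} E-linear F-linear r s u v w w≡ =
  trans (cong₂ _+_ (E-linear r s u v w w≡) (F-linear r s u v w w≡)) (collect r s (E u) (E v) (F u) (F v))
  where
  collect : ∀ r s a a′ b b′ → (r * a + s * a′) + (r * b + s * b′) ≡ r * (a + b) + s * (a′ + b′)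
  collect = solve-∀

minus-linear : ∀ {N} {E F : Functional N} → IsLinear E → IsLinear F → IsLinear (λ v → E v - F v)
minus-linear {E = E} {F} E-linear F-linear r s u v w w≡ =
  trans (cong₂ _-_ (E-linear r s u v w w≡) (F-linear r s u v w w≡)) (collect r s (E u) (E v) (F u) (F v))
  where
  collect : ∀ r s a a′ b b′ → (r * a + s * a′) - (r * b + s * b′) ≡ r * (a - b) + s * (a′ - b′)
  collect = solve-∀

scale-linear : ∀ {N} {E : Functional N} (z : ℤ) → IsLinear E → IsLinear (λ v → E v * z)
scale-linear {E = E} z E-linear r s u v w w≡ =
  trans (cong (_* z) (E-linear r s u v w w≡)) (collect r s (E u) (E v) z)
  where
  collect : ∀ r s a a′ z → (r * a + s * a′) * z ≡ r * (a * z) + s * (a′ * z)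
  collect = solve-∀

module _ {N : ℕ} (E : Functional (suc N)) (E-linear : IsLinear E) where

  e₀ : Fin (suc N) → ℤ
  e₀ = 1ℤ Vector.∷ λ _ → 0ℤ

  -- Extends w to a zero of E, scaled by E e₀ so as to stay integral.
  lift : (Fin N → ℤ) → Fin (suc N) → ℤ
  lift w = - E (0ℤ Vector.∷ w) Vector.∷ λ i → E e₀ * w i

  E-lift : ∀ w → E (lift w) ≡ 0ℤ
  E-lift w = trans
    (E-linear (- E (0ℤ Vector.∷ w)) (E e₀) e₀ (0ℤ Vector.∷ w) (lift w) coord)
    (cancel (E (0ℤ Vector.∷ w)) (E e₀))
    where
    cancel : ∀ x y → - x * y + y * x ≡ 0ℤ
    cancel = solve-∀
    head-coord : ∀ x y → x ≡ x * 1ℤ + y * 0ℤ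
    head-coord = solve-∀
    tail-coord : ∀ x y → y ≡ x * 0ℤ + y
    tail-coord = solve-∀
    coord : ∀ i → lift w i ≡ - E (0ℤ Vector.∷ w) * e₀ i + E e₀ * (0ℤ Vector.∷ w) i
    coord zero    = head-coord _ (E e₀)
    coord (suc i) = tail-coord (- E (0ℤ Vector.∷ w)) _

  ∘lift-linear : ∀ {E′} → IsLinear E′ → IsLinear (E′ ∘ lift)
  ∘lift-linear E′-linear r s u v w w≡ =
    E′-linear r s (lift u) (lift v) (lift w) coord
    where
    zero-coord : ∀ r s → 0ℤ ≡ r * 0ℤ + s * 0ℤ
    zero-coord = solve-∀
    distrib₁ : ∀ r s x y → - (r * x + s * y) ≡ r * - x + s * - y
    distrib₁ = solve-∀
    distrib₂ : ∀ r s e x y → e * (r * x + s * y) ≡ r * (e * x) + s * (e * y)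
    distrib₂ = solve-∀
    cons : ∀ i → (0ℤ Vector.∷ w) i ≡ r * (0ℤ Vector.∷ u) i + s * (0ℤ Vector.∷ v) i
    cons zero    = zero-coord r s
    cons (suc i) = w≡ i
    coord : ∀ i → lift w i ≡ r * lift u i + s * lift v i
    coord zero    = trans (cong -_ (E-linear r s _ _ _ cons)) (distrib₁ r s _ _)
    coord (suc i) = trans (cong (E e₀ *_) (w≡ i)) (distrib₂ r s (E e₀) _ _)

-- Fraction-free Gaussian elimination. If no equation involves the first unknown, `e₀` is a
-- solution. Otherwise some `E` with `E e₀ ≢ 0ℤ` eliminates that unknown: composing the others with
-- `lift` leaves one equation and one unknown fewer, and a nonzero `w i` stays nonzero after scaling
-- by `E e₀`.
underdetermined : ∀ N (Es : List (Functional N)) → All IsLinear Es → length Es < N →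
  ∃ λ v → (∃ λ i → v i ≢ 0ℤ) × All (λ E → E v ≡ 0ℤ) Es
underdetermined (suc N) Es linear <N
  with any? (λ E → ¬? (E (1ℤ Vector.∷ λ _ → 0ℤ) ℤ.≟ 0ℤ)) Es
... | no ∄ = (1ℤ Vector.∷ λ _ → 0ℤ) , (zero , λ ()) ,
             All.map (λ {E} → decidable-stable (E _ ℤ.≟ 0ℤ)) (All.¬Any⇒All¬ Es ∄)
... | yes ∃E with find ∃E
... | E , E∈Es , Ee₀≢0 with ∈-∃++ E∈Es
... | pre , post , Es≡ with ↭-trans (↭-reflexive Es≡) (shift E pre post)
... | perm with All-resp-↭ perm linear
... | E-linear ∷ rest-linear
  with underdetermined N (map (_∘ lift E E-linear) (pre ++ post))
         (All.map⁺ (All.map (∘lift-linear E E-linear) rest-linear))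
         (subst (ℕ._< N) (sym (List.length-map _ (pre ++ post)))
           (ℕ.s<s⁻¹ (subst (ℕ._< suc N) (↭-length perm) <N)))
... | w , (i , wᵢ≢0) , zeros =
  lift E E-linear w
  , (suc i , λ p → [ Ee₀≢0 , wᵢ≢0 ]′ (ℤ.i*j≡0⇒i≡0∨j≡0 _ p))
  , All-resp-↭ (↭-sym perm) (E-lift E E-linear w ∷ All.map⁻ zeros)

-- Colourings of the faces

module ℕΣ = Sum ℕ.+-*-semiring
module ℤΣ = Sum ℤ.+-*-semiring

ind : ∀ {P : Set} → Dec P → ℕ
ind P? = if does P? then 1 else 0

ind-yes : ∀ {P : Set} (P? : Dec P) → P → ind P? ≡ 1
ind-yes P? p rewrite dec-true P? p = refl

ind-no : ∀ {P : Set} (P? : Dec P) → ¬ P → ind P? ≡ 0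
ind-no P? ¬p rewrite dec-false P? ¬p = refl

ind-¬ : ∀ {P : Set} (P? : Dec P) → ind (¬? P?) ℕ.+ ind P? ≡ 1
ind-¬ P? with does P?
... | true  = refl
... | false = refl

length-filter-tabulate : ∀ {A : Set} {Q : A → Set} (Q? : Decidable Q) {n} (f : Fin n → A) →
  length (filter Q? (tabulate f)) ≡ ℕΣ.sum (λ i → ind (Q? (f i)))
length-filter-tabulate Q? {zero}  f = refl
length-filter-tabulate Q? {suc n} f with does (Q? (f zero))
... | true  = cong suc (length-filter-tabulate Q? (f ∘ suc))
... | false = length-filter-tabulate Q? (f ∘ suc)

sum-ones : ∀ n (f : Fin n → ℕ) → (∀ i → f i ≡ 1) → ℕΣ.sum f ≡ n
sum-ones zero    f f≡1 = refl
sum-ones (suc n) f f≡1 = cong₂ ℕ._+_ (f≡1 zero) (sum-ones n (f ∘ suc) (f≡1 ∘ suc))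

square-nonneg : ∀ i → ∃ λ k → i * i ≡ + k × (k ≡ 0 → i ≡ 0ℤ)
square-nonneg (+ n)    = n ℕ.* n , sym (ℤ.pos-* n n) ,
  λ p → cong +_ ([ id , id ]′ (ℕ.m*n≡0⇒m≡0∨n≡0 n p))
square-nonneg -[1+ n ] = suc n ℕ.* suc n , refl , λ ()

sum-squares-nonneg : ∀ n (f : Fin n → ℤ) →
  ∃ λ k → ℤΣ.sum (λ i → f i * f i) ≡ + k × (k ≡ 0 → ∀ i → f i ≡ 0ℤ)
sum-squares-nonneg zero    f = 0 , refl , λ _ ()
sum-squares-nonneg (suc n) f
  with square-nonneg (f zero) | sum-squares-nonneg n (f ∘ suc)
... | k , sq≡ , sq-zero | l , sum≡ , sum-zero =
  k ℕ.+ l , trans (cong₂ _+_ sq≡ sum≡) (sym (ℤ.pos-+ k l)) , λ where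
    k+l≡0 zero    → sq-zero (ℕ.m+n≡0⇒m≡0 k k+l≡0)
    k+l≡0 (suc i) → sum-zero (ℕ.m+n≡0⇒n≡0 k k+l≡0) i

sum-squares≡0 : ∀ {n} (f : Fin n → ℤ) → ℤΣ.sum (λ i → f i * f i) ≡ 0ℤ → ∀ i → f i ≡ 0ℤ
sum-squares≡0 f p with sum-squares-nonneg _ f
... | k , sum≡ , vanish = vanish (ℤ.+-injective (trans (sym sum≡) p))

-- Counting the faces and edges of the map

module _ {n : ℕ} (P : SphereTriangulation n) where
  open SphereTriangulation P

  φ : Fin d → Fin d
  φ x = σ (α x)

  head : Fin d → Fin n
  head x = vert (α x)

  σ-perm : Permutation d d
  σ-perm = permutation σ σ⁻¹ σσ⁻¹ σ⁻¹σ

  α-perm : Permutation d d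
  α-perm = permutation α α α-invol α-invol

  φ-perm : Permutation d d
  φ-perm = permutation φ (α ∘ σ⁻¹)
    (λ x → trans (cong σ (α-invol _)) (σσ⁻¹ x)) (λ x → trans (cong α (σ⁻¹σ _)) (α-invol x))

  φα : ∀ x → φ (α x) ≡ σ x
  φα x = cong σ (α-invol x)

  open Min (Fin.≤-totalOrder d) using (_⊓_; ⊓-sel; ⊓-assoc; ⊓-comm)

  abstract
    -- The least dart of the face of `x`. It is kept opaque: `rep-φ` and `rep-cases` are its
    -- interface.
    rep : Fin d → Fin d
    rep x = x ⊓ (φ x ⊓ φ (φ x))

    rep-φ : ∀ x → rep (φ x) ≡ rep x
    rep-φ x = begin
      φ x ⊓ (φ (φ x) ⊓ φ (φ (φ x))) ≡⟨ cong (λ y → φ x ⊓ (φ (φ x) ⊓ y)) (face-tri₃ x) ⟩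
      φ x ⊓ (φ (φ x) ⊓ x)           ≡⟨ ⊓-assoc (φ x) (φ (φ x)) x ⟨
      (φ x ⊓ φ (φ x)) ⊓ x           ≡⟨ ⊓-comm _ x ⟩
      rep x                         ∎
      where open ≡-Reasoning

    rep-cases : ∀ x → rep x ≡ x ⊎ rep x ≡ φ x ⊎ rep x ≡ φ (φ x)
    rep-cases x with ⊓-sel x (φ x ⊓ φ (φ x))
    ... | inj₁ p = inj₁ p
    ... | inj₂ p with ⊓-sel (φ x) (φ (φ x))
    ...   | inj₁ q = inj₂ (inj₁ (trans p q))
    ...   | inj₂ q = inj₂ (inj₂ (trans p q))

  rep≟ : Decidable (λ x → rep x ≡ x)
  rep≟ x = rep x Fin.≟ x

  -- Faces are identified with the darts fixed by rep.
  #faces : ℕ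
  #faces = ℕΣ.sum (λ x → ind (rep≟ x))

  φ²≢ : ∀ x → φ (φ x) ≢ x
  φ²≢ x p = face-tri₁ x (trans (cong φ (sym p)) (face-tri₃ x))

  rep-orbit : ∀ x → ind (rep≟ x) ℕ.+ (ind (rep≟ (φ x)) ℕ.+ ind (rep≟ (φ (φ x)))) ≡ 1
  rep-orbit x with rep-cases x
  ... | inj₁ p
      rewrite ind-yes (rep≟ x) p
            | ind-no (rep≟ (φ x)) (λ q → face-tri₁ x (trans (sym q) (trans (rep-φ x) p)))
            | ind-no (rep≟ (φ (φ x)))
                (λ q → φ²≢ x (trans (sym q) (trans (rep-φ _) (trans (rep-φ x) p)))) = refl
  ... | inj₂ (inj₁ p)
      rewrite ind-no (rep≟ x) (λ q → face-tri₁ x (trans (sym p) q))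
            | ind-yes (rep≟ (φ x)) (trans (rep-φ x) p)
            | ind-no (rep≟ (φ (φ x)))
                (λ q → face-tri₁ (φ x) (trans (sym q) (trans (rep-φ _) (trans (rep-φ x) p)))) = refl
  ... | inj₂ (inj₂ p)
      rewrite ind-no (rep≟ x) (λ q → φ²≢ x (trans (sym p) q))
            | ind-no (rep≟ (φ x)) (λ q → face-tri₁ (φ x) (trans (sym p) (trans (sym (rep-φ x)) q)))
            | ind-yes (rep≟ (φ (φ x))) (trans (rep-φ _) (trans (rep-φ x) p)) = refl

  -- A sum over all darts is invariant under the permutation `φ`, so three copies of the count add
  -- up `rep-orbit` over all darts.
  #faces*3 : #faces ℕ.* 3 ≡ d
  #faces*3 = begin
    #faces ℕ.* 3                         ≡⟨ triple #faces ⟩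
    #faces ℕ.+ (#faces ℕ.+ #faces)
      ≡⟨ cong (#faces ℕ.+_) (cong₂ ℕ._+_ (ℕΣ.sum-permute r φ-perm)
           (trans (ℕΣ.sum-permute r φ-perm) (ℕΣ.sum-permute (r ∘ φ) φ-perm))) ⟩
    ℕΣ.sum r ℕ.+ (ℕΣ.sum (r ∘ φ) ℕ.+ ℕΣ.sum (r ∘ φ ∘ φ))
      ≡⟨ cong (ℕΣ.sum r ℕ.+_) (ℕΣ.∑-distrib-+ (r ∘ φ) (r ∘ φ ∘ φ)) ⟨
    ℕΣ.sum r ℕ.+ ℕΣ.sum (λ x → r (φ x) ℕ.+ r (φ (φ x)))
      ≡⟨ ℕΣ.∑-distrib-+ r (λ x → r (φ x) ℕ.+ r (φ (φ x))) ⟨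
    ℕΣ.sum (λ x → r x ℕ.+ (r (φ x) ℕ.+ r (φ (φ x))))
      ≡⟨ sum-ones d _ rep-orbit ⟩
    d ∎
    where
    open ≡-Reasoning
    r : Fin d → ℕ
    r x = ind (rep≟ x)
    triple : ∀ k → k ℕ.* 3 ≡ k ℕ.+ (k ℕ.+ k)
    triple = ℕSolver.solve-∀

  n+#faces : n ℕ.+ #faces ≡ m ℕ.+ 2
  n+#faces = trans (cong (n ℕ.+_) (trans (sym (ℕ.m*n/n≡m #faces 3)) (cong (ℕ._/ 3) #faces*3))) euler

  non-reps : List (Fin d)
  non-reps = filter (λ x → ¬? (rep≟ x)) (allFin d)

  length-non-reps : length non-reps ℕ.+ #faces ≡ d
  length-non-reps = begin
    length non-reps ℕ.+ #faces
      ≡⟨ cong (ℕ._+ #faces) (length-filter-tabulate (λ x → ¬? (rep≟ x)) id) ⟩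
    ℕΣ.sum (λ x → ind (¬? (rep≟ x))) ℕ.+ #faces
      ≡⟨ ℕΣ.∑-distrib-+ {d} (λ x → ind (¬? (rep≟ x))) (λ x → ind (rep≟ x)) ⟨
    ℕΣ.sum (λ x → ind (¬? (rep≟ x)) ℕ.+ ind (rep≟ x))
      ≡⟨ sum-ones d _ (λ x → ind-¬ (rep≟ x)) ⟩
    d ∎
    where open ≡-Reasoning

  edges : List (Fin d)
  edges = filter (λ x → x Fin.<? α x) (allFin d)

  edge-orbit : ∀ x → ind (x Fin.<? α x) ℕ.+ ind (α x Fin.<? α (α x)) ≡ 1
  edge-orbit x rewrite α-invol x with Fin.<-cmp x (α x)
  ... | tri< p _ q rewrite ind-yes (x Fin.<? α x) p | ind-no (α x Fin.<? x) q = refl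
  ... | tri≈ _ p _ = contradiction (sym p) (α-fpf x)
  ... | tri> p _ q rewrite ind-no (x Fin.<? α x) p | ind-yes (α x Fin.<? x) q = refl

  -- The same count with `α` in place of `φ`: `x < α x` selects one dart of each edge.
  length-edges : length edges ≡ m
  length-edges = ℕ.*-cancelˡ-≡ _ _ 2 (begin
    2 ℕ.* length edges                    ≡⟨ cong (2 ℕ.*_) (length-filter-tabulate (λ x → x Fin.<? α x) id) ⟩
    2 ℕ.* ℕΣ.sum o                        ≡⟨ double (ℕΣ.sum o) ⟩
    ℕΣ.sum o ℕ.+ ℕΣ.sum o                 ≡⟨ cong (ℕΣ.sum o ℕ.+_) (ℕΣ.sum-permute o α-perm) ⟩
    ℕΣ.sum o ℕ.+ ℕΣ.sum (o ∘ α)           ≡⟨ ℕΣ.∑-distrib-+ o (o ∘ α) ⟨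
    ℕΣ.sum (λ x → o x ℕ.+ o (α x))        ≡⟨ sum-ones d _ edge-orbit ⟩
    d                                     ≡⟨ d≡2m ⟩
    2 ℕ.* m                               ∎)
    where
    open ≡-Reasoning
    o : Fin d → ℕ
    o x = ind (x Fin.<? α x)
    double : ∀ k → 2 ℕ.* k ≡ k ℕ.+ k
    double = ℕSolver.solve-∀

  -- An integral 1-cycle. `closed` expresses conservation at the vertices in weak form, by testing
  -- against every vertex function `h`.
  record IsCycle (Z : Fin d → ℤ) : Set where
    field
      antisym : ∀ x → Z (α x) ≡ - Z x
      closed  : ∀ (h : Fin n → ℤ) → ℤΣ.sum (λ x → h (vert x) * Z x) ≡ 0ℤ

  -- A function on faces whose boundary is a nonzero multiple of `Z`, so that `Z` is null-homologous
  -- over the rationals. The factor `step` arises because the linear system is solved over the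
  -- integers.
  record Coloring (Z : Fin d → ℤ) : Set where
    field
      color   : Fin d → ℤ
      step    : ℤ
      step≢0  : step ≢ 0ℤ
      color-φ : ∀ x → color (φ x) ≡ color x
      color-α : ∀ x → color (α x) ≡ color x + step * Z x

    -- `σ x` lies on the face of `α x`, so turning from `x` to `σ x` crosses the edge of `x`.
    color-σ : ∀ x → color (σ x) ≡ color x + step * Z x
    color-σ x = trans (trans (cong color (sym (φα x))) (color-φ (α x))) (color-α x)

  -- If ∂c + l·Z is a gradient δh then it is orthogonal to itself, hence zero.
  gradient-cycle≡0 : ∀ {Z} → IsCycle Z → (c : Fin d → ℤ) (l : ℤ) (h : Fin n → ℤ) →
    (∀ x → c (φ x) ≡ c x) →
    (∀ x → (c (α x) - c x) + l * Z x ≡ h (head x) - h (vert x)) →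
    ∀ x → h (head x) - h (vert x) ≡ 0ℤ
  gradient-cycle≡0 {Z} cyc c l h c-φ W≡ = sum-squares≡0 W (begin
    ℤΣ.sum (λ x → W x * W x)
      ≡⟨ ℤΣ.sum-cong-≗ {d} squares ⟩
    ℤΣ.sum (λ x → - 1ℤ * (HW (α x)) + - 1ℤ * HW x)
      ≡⟨ ℤΣ.∑-distrib-+ {d} (λ x → - 1ℤ * HW (α x)) (λ x → - 1ℤ * HW x) ⟩
    ℤΣ.sum (λ x → - 1ℤ * HW (α x)) + ℤΣ.sum (λ x → - 1ℤ * HW x)
      ≡⟨ cong₂ _+_ (ℤΣ.sum-permute (λ x → - 1ℤ * HW x) α-perm) refl ⟨
    ℤΣ.sum (λ x → - 1ℤ * HW x) + ℤΣ.sum (λ x → - 1ℤ * HW x)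
      ≡⟨ cong (λ s → s + s) (trans (sym (ℤΣ.*-distribˡ-sum {d} (- 1ℤ) HW)) (cong (- 1ℤ *_) ⟨h,W⟩≡0)) ⟩
    0ℤ ∎)
    where
    open ≡-Reasoning
    open IsCycle cyc
    W HW K : Fin d → ℤ
    W x = h (head x) - h (vert x)
    HW x = h (vert x) * W x
    K x = h (vert x) * c x
    split : ∀ a b → (a - b) * (a - b) ≡ - 1ℤ * (a * (b - a)) + - 1ℤ * (b * (a - b))
    split = solve-∀
    -- Summation by parts: `W` changes sign under `α`, so the sum of its squares is -2 times the sum
    -- of `HW`.
    squares : ∀ x → W x * W x ≡ - 1ℤ * HW (α x) + - 1ℤ * HW x
    squares x rewrite α-invol x = split (h (head x)) (h (vert x))
    expand : ∀ a b e l z → a * ((b - e) + l * z) ≡ a * b + (- 1ℤ * (a * e) + l * (a * z))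
    expand = solve-∀
    cancel : ∀ s → s + (- 1ℤ * s + l * 0ℤ) ≡ 0ℤ
    cancel = cancel′ l
      where
      cancel′ : ∀ l s → s + (- 1ℤ * s + l * 0ℤ) ≡ 0ℤ
      cancel′ = solve-∀
    terms : ∀ x → HW x ≡ K (σ x) + (- 1ℤ * K x + l * (h (vert x) * Z x))
    terms x = trans (cong (h (vert x) *_) (sym (W≡ x)))
      (trans (expand (h (vert x)) (c (α x)) (c x) l (Z x))
        (cong₂ _+_ (cong₂ _*_ (cong h (sym (vert-σ x)))
          (trans (sym (c-φ (α x))) (cong c (φα x)))) refl))
    -- Replace `W` by its other expression. The face terms cancel, as `c (α x)` equals `c (σ x)` and
    -- `σ` permutes the darts at each vertex; the `Z` term vanishes by `closed`.
    ⟨h,W⟩≡0 : ℤΣ.sum HW ≡ 0ℤ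
    ⟨h,W⟩≡0 = begin
      ℤΣ.sum HW
        ≡⟨ ℤΣ.sum-cong-≗ terms ⟩
      ℤΣ.sum (λ x → K (σ x) + (- 1ℤ * K x + l * (h (vert x) * Z x)))
        ≡⟨ ℤΣ.∑-distrib-+ {d} (K ∘ σ) (λ x → - 1ℤ * K x + l * (h (vert x) * Z x)) ⟩
      ℤΣ.sum (K ∘ σ) + ℤΣ.sum (λ x → - 1ℤ * K x + l * (h (vert x) * Z x))
        ≡⟨ cong₂ _+_ (ℤΣ.sum-permute K σ-perm)
             (sym (ℤΣ.∑-distrib-+ {d} (λ x → - 1ℤ * K x) (λ x → l * (h (vert x) * Z x)))) ⟨
      ℤΣ.sum K + (ℤΣ.sum (λ x → - 1ℤ * K x) + ℤΣ.sum (λ x → l * (h (vert x) * Z x)))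
        ≡⟨ cong₂ _+_ (refl {x = ℤΣ.sum K}) (cong₂ _+_ (ℤΣ.*-distribˡ-sum {d} (- 1ℤ) K)
             (ℤΣ.*-distribˡ-sum {d} l (λ x → h (vert x) * Z x))) ⟨
      ℤΣ.sum K + (- 1ℤ * ℤΣ.sum K + l * ℤΣ.sum (λ x → h (vert x) * Z x))
        ≡⟨ cong (λ s → ℤΣ.sum K + (- 1ℤ * ℤΣ.sum K + l * s)) (closed h) ⟩
      ℤΣ.sum K + (- 1ℤ * ℤΣ.sum K + l * 0ℤ)
        ≡⟨ cancel (ℤΣ.sum K) ⟩
      0ℤ ∎

  -- Existence of face colourings

  module _ {Z : Fin d → ℤ} (cyc : IsCycle Z) where
    open IsCycle cyc

    private
      root : Fin d
      root = proj₁ (vert-surj (Fin.fromℕ< (ℕ.≤-trans (s≤s z≤n) three≤n)))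

      -- The system says that the boundary of `face` plus `scalar` times `Z` is the gradient of
      -- `potential`. The potential is slack: it makes the unknowns outnumber the equations, and is
      -- shown to vanish afterwards.
      module Unknowns (v : Fin (d ℕ.+ suc n) → ℤ) where
        faceRaw : Fin d → ℤ
        faceRaw x = v (x ↑ˡ suc n)

        face : Fin d → ℤ
        face x = faceRaw (rep x)

        potential : Fin n → ℤ
        potential u = v (d ↑ʳ suc u)

        scalar : ℤ
        scalar = v (d ↑ʳ zero)

        defect : Fin d → ℤ
        defect x = ((face (α x) - face x) + scalar * Z x) - (potential (head x) - potential (vert x))

      open Unknowns

      -- Values at non-representatives are set to zero, leaving one unknown per face. The last two
      -- equations fix the additive constants of `face` and `potential`.
      equations : List (Functional (d ℕ.+ suc n))
      equations = map (λ x v → faceRaw v x) non-reps ++ map (λ x v → defect v x) edges ++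
        (λ v → face v root) ∷ (λ v → potential v (vert root)) ∷ []

      defect-linear : ∀ x → IsLinear (λ v → defect v x)
      defect-linear x =
        minus-linear
          (plus-linear (minus-linear (coordinate-linear _) (coordinate-linear _))
            (scale-linear (Z x) (coordinate-linear _)))
          (minus-linear (coordinate-linear _) (coordinate-linear _))

      equations-linear : All IsLinear equations
      equations-linear = All.++⁺ (All.map⁺ (All.universal (λ _ → coordinate-linear _) non-reps))
        (All.++⁺ (All.map⁺ (All.universal defect-linear edges))
          (coordinate-linear _ ∷ coordinate-linear _ ∷ []))

      -- There are `d - #faces` equations for non-representatives and `m + 2` others; Euler's
      -- formula turns `m + 2` into `n + #faces`. The unknowns number one more than the total.
      length-equations : length equations ≡ d ℕ.+ n
      length-equations = ℕ.+-cancelʳ-≡ #faces _ _ (begin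
        length equations ℕ.+ #faces
          ≡⟨ cong (ℕ._+ #faces) (trans (List.length-++ (map _ non-reps))
               (cong₂ ℕ._+_ (List.length-map _ non-reps) (trans (List.length-++ (map _ edges))
                 (cong (ℕ._+ 2) (trans (List.length-map _ edges) length-edges))))) ⟩
        length non-reps ℕ.+ (m ℕ.+ 2) ℕ.+ #faces
          ≡⟨ swap (length non-reps) (m ℕ.+ 2) #faces ⟩
        (length non-reps ℕ.+ #faces) ℕ.+ (m ℕ.+ 2)
          ≡⟨ cong₂ ℕ._+_ length-non-reps (sym n+#faces) ⟩
        d ℕ.+ (n ℕ.+ #faces)
          ≡⟨ ℕ.+-assoc d n #faces ⟨
        d ℕ.+ n ℕ.+ #faces ∎)
        where
        open ≡-Reasoning
        swap : ∀ a b c → a ℕ.+ b ℕ.+ c ≡ (a ℕ.+ c) ℕ.+ b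
        swap = ℕSolver.solve-∀

    -- The gradient vanishes by `gradient-cycle≡0`, so the potential is constant, hence zero. If
    -- `scalar` were zero too, `face` would be constant, hence zero, and so would be all of `v`.
    solution⇒coloring : ∀ v → (∃ λ i → v i ≢ 0ℤ) → All (λ E → E v ≡ 0ℤ) equations → Coloring Z
    solution⇒coloring v (i , vᵢ≢0) zeros = record
      { color   = face v
      ; step    = - scalar v
      ; step≢0  = λ p → scalar≢0 (trans (sym (ℤ.neg-involutive _)) (cong -_ p))
      ; color-φ = face-φ
      ; color-α = λ x → solve-for (face v (α x)) (face v x) (scalar v) (Z x) (trans (face-edge x) (gradient≡0 x))
      }
      where
      solve-for : ∀ a b l z → (a - b) + l * z ≡ 0ℤ → a ≡ b + - l * z
      solve-for a b l z p = trans (lhs a b l z) (trans (cong (_+ (b + - l * z)) p) (ℤ.+-identityˡ _))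
        where
        lhs : ∀ a b l z → a ≡ ((a - b) + l * z) + (b + - l * z)
        lhs = solve-∀

      zeros₁ = All.map⁻ (All.++⁻ˡ (map _ non-reps) zeros)
      zeros₂₃ = All.++⁻ʳ (map _ non-reps) zeros
      zeros₂ = All.map⁻ (All.++⁻ˡ (map _ edges) zeros₂₃)

      root-zeros : face v root ≡ 0ℤ × potential v (vert root) ≡ 0ℤ
      root-zeros with All.++⁻ʳ (map _ edges) zeros₂₃
      ... | p ∷ q ∷ [] = p , q

      face-φ : ∀ x → face v (φ x) ≡ face v x
      face-φ x = cong (faceRaw v) (rep-φ x)

      negate : ∀ a b l z c e →
        ((b - a) + l * (- z)) - (e - c) ≡ - (((a - b) + l * z) - (c - e))
      negate = solve-∀

      -- The system contains one dart of each edge; antisymmetry supplies the other dart.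
      defect-α : ∀ x → defect v (α x) ≡ - defect v x
      defect-α x = trans
        (cong₂ (λ y z → ((face v y - face v (α x)) + scalar v * z) - (potential v (vert y) - potential v (head x)))
          (α-invol x) (antisym x))
        (negate (face v (α x)) (face v x) (scalar v) (Z x) (potential v (head x)) (potential v (vert x)))

      defect≡0 : ∀ x → defect v x ≡ 0ℤ
      defect≡0 x with Fin.<-cmp x (α x)
      ... | tri< p _ _ = All.lookup zeros₂ (∈-filter⁺ (λ x → x Fin.<? α x) (∈-allFin x) p)
      ... | tri≈ _ p _ = contradiction (sym p) (α-fpf x)
      ... | tri> _ _ p = trans (sym (ℤ.neg-involutive _)) (cong -_ (trans (sym (defect-α x))
          (All.lookup zeros₂ (∈-filter⁺ (λ x → x Fin.<? α x) (∈-allFin (α x))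
            (subst (α x Fin.<_) (sym (α-invol x)) p)))))

      face-edge : ∀ x → (face v (α x) - face v x) + scalar v * Z x
        ≡ potential v (head x) - potential v (vert x)
      face-edge x = ℤ.i-j≡0⇒i≡j _ _ (defect≡0 x)

      gradient≡0 : ∀ x → potential v (head x) - potential v (vert x) ≡ 0ℤ
      gradient≡0 = gradient-cycle≡0 cyc (face v) (scalar v) (potential v) face-φ face-edge

      constant : (g : Fin d → ℤ) → (∀ x → g (σ x) ≡ g x) → (∀ x → g (α x) ≡ g x) →
        g root ≡ 0ℤ → ∀ x → g x ≡ 0ℤ
      constant g g-σ g-α g₀ x = go (connected root x)
        where
        go : ∀ {y} → Reach σ α root y → g y ≡ 0ℤ
        go here      = g₀
        go (stepσ r) = trans (g-σ _) (go r)
        go (stepα r) = trans (g-α _) (go r)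

      potential≡0 : ∀ u → potential v u ≡ 0ℤ
      potential≡0 u with vert-surj u
      ... | x , refl = constant (potential v ∘ vert) (λ y → cong (potential v) (vert-σ y))
              (λ y → ℤ.i-j≡0⇒i≡j _ _ (gradient≡0 y)) (proj₂ root-zeros) x

      scalar≢0 : scalar v ≢ 0ℤ
      scalar≢0 s≡0 = vᵢ≢0 (trans (cong v (sym (Fin.join-splitAt d (suc n) i))) (all-zero (Fin.splitAt d i)))
        where
        face-α : ∀ x → face v (α x) ≡ face v x
        face-α x = ℤ.i-j≡0⇒i≡j _ _ (trans (sym (ℤ.+-identityʳ _))
          (trans (cong (λ s → (face v (α x) - face v x) + s) (sym (cong (_* Z x) s≡0)))
            (trans (face-edge x) (gradient≡0 x))))
        face≡0 : ∀ x → face v x ≡ 0ℤ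
        face≡0 = constant (face v)
          (λ x → trans (trans (cong (face v) (sym (φα x))) (face-φ (α x))) (face-α x)) face-α
          (proj₁ root-zeros)
        all-zero : ∀ j → v (Fin.join d (suc n) j) ≡ 0ℤ
        all-zero (inj₁ x) with rep≟ x
        ... | yes p = trans (cong (faceRaw v) (sym p)) (face≡0 x)
        ... | no ¬p = All.lookup zeros₁ (∈-filter⁺ (λ x → ¬? (rep≟ x)) (∈-allFin x) ¬p)
        all-zero (inj₂ zero)    = s≡0
        all-zero (inj₂ (suc u)) = potential≡0 u

    abstract
      -- This is the vanishing of the first rational homology of the sphere.
      cycle-coloring : Coloring Z
      cycle-coloring =
        let v , nonzero , zeros = underdetermined (d ℕ.+ suc n) equations equations-linear
              (subst₂ ℕ._<_ (sym length-equations) (sym (ℕ.+-suc d n)) ℕ.≤-refl)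
        in solution⇒coloring v nonzero zeros

-- Cycles and links

least : ∀ {Q : ℕ → Set} → Decidable Q → ∀ l → Q l → ∃ λ k → Q k × (∀ i → i < k → ¬ Q i)
least Q? l q with Q? 0
... | yes q₀ = 0 , q₀ , λ _ ()
least Q? zero    q | no ¬q₀ = contradiction q ¬q₀
least Q? (suc l) q | no ¬q₀ with least (Q? ∘ suc) l q
... | k , qk , below = suc k , qk , λ where
  zero    _         → ¬q₀
  (suc i) (s≤s i<k) → below i i<k

iter-+ : ∀ {A : Set} (f : A → A) a b x → iter f (a ℕ.+ b) x ≡ iter f a (iter f b x)
iter-+ f zero    b x = refl
iter-+ f (suc a) b x = cong f (iter-+ f a b x)

iter-suc : ∀ {A : Set} (f : A → A) a x → iter f a (f x) ≡ iter f (suc a) x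
iter-suc f zero    x = refl
iter-suc f (suc a) x = cong f (iter-suc f a x)

iter-injective : ∀ {A : Set} (f : A → A) → (∀ {x y} → f x ≡ f y → x ≡ y) →
  ∀ a {x y} → iter f a x ≡ iter f a y → x ≡ y
iter-injective f inj zero    p = p
iter-injective f inj (suc a) p = iter-injective f inj a (inj p)

δ : ∀ {d} → Fin d → Fin d → ℤ
δ s a = if does (s Fin.≟ a) then 1ℤ else 0ℤ

δ-≡ : ∀ {d} (s : Fin d) → δ s s ≡ 1ℤ
δ-≡ s rewrite dec-true (s Fin.≟ s) refl = refl

δ-≢ : ∀ {d} {s a : Fin d} → s ≢ a → δ s a ≡ 0ℤ
δ-≢ {s = s} {a} s≢a rewrite dec-false (s Fin.≟ a) s≢a = refl

sum-δ : ∀ {d} (g : Fin d → ℤ) a → ℤΣ.sum (λ s → g s * δ s a) ≡ g a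
sum-δ {suc d} g zero = trans
  (cong₂ _+_ (ℤ.*-identityʳ (g zero)) (sum-zeros (λ s → ℤ.*-zeroʳ (g (suc s)))))
  (ℤ.+-identityʳ (g zero))
  where
  sum-zeros : ∀ {n} {f : Fin n → ℤ} → (∀ i → f i ≡ 0ℤ) → ℤΣ.sum f ≡ 0ℤ
  sum-zeros {n} f≡0 = trans (ℤΣ.sum-cong-≗ f≡0) (ℤΣ.sum-replicate-zero n)
sum-δ {suc d} g (suc a) = trans (cong₂ _+_ (ℤ.*-zeroʳ (g zero)) refl)
  (trans (ℤ.+-identityˡ _) (sum-δ (g ∘ suc) a))

-- Closed walks and the rotation around a vertex

module _ {n : ℕ} (P : SphereTriangulation n) where
  open SphereTriangulation P

  hd : Fin d → Fin n
  hd = head P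

  σ-injective : ∀ {x y} → σ x ≡ σ y → x ≡ y
  σ-injective {x} {y} p = trans (sym (σ⁻¹σ x)) (trans (cong σ⁻¹ p) (σ⁻¹σ y))

  head-α : ∀ x → hd (α x) ≡ vert x
  head-α x = cong vert (α-invol x)

  vert-iter : ∀ k x → vert (iter σ k x) ≡ vert x
  vert-iter zero    x = refl
  vert-iter (suc k) x = trans (vert-σ _) (vert-iter k x)

  chain : List (Fin d) → Fin d → ℤ
  chain []       s = 0ℤ
  chain (a ∷ as) s = (δ s a - δ s (α a)) + chain as s

  data Walk : Fin n → List (Fin d) → Fin n → Set where
    []   : ∀ {u} → Walk u [] u
    _∷_  : ∀ {u v a as} → vert a ≡ u → Walk (hd a) as v → Walk u (a ∷ as) v

  chain-antisym : ∀ as s → chain as (α s) ≡ - chain as s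
  chain-antisym []       s = refl
  chain-antisym (a ∷ as) s = trans
    (cong₂ _+_ (cong₂ _-_ (δ-α a) (trans (δ-α (α a)) (cong (δ s) (α-invol a)))) (chain-antisym as s))
    (negate (δ s (α a)) (δ s a) (chain as s))
    where
    negate : ∀ x y z → (x - y) + - z ≡ - ((y - x) + z)
    negate = solve-∀
    δ-α : ∀ b → δ (α s) b ≡ δ s (α b)
    δ-α b with s Fin.≟ α b
    ... | yes refl = trans (cong (λ y → δ y b) (α-invol b)) (δ-≡ b)
    ... | no s≢αb = δ-≢ (λ p → s≢αb (trans (sym (α-invol s)) (cong α p)))

  -- Each dart contributes the difference of `h` at its two ends, and these telescope along the
  -- walk.
  chain-boundary : ∀ {u v as} → Walk u as v → (h : Fin n → ℤ) →
    ℤΣ.sum (λ s → h (vert s) * chain as s) ≡ h u - h v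
  chain-boundary {u} [] h = trans
    (trans (ℤΣ.sum-cong-≗ {d} (λ s → ℤ.*-zeroʳ (h (vert s)))) (ℤΣ.sum-replicate-zero d))
    (sym (ℤ.+-inverseʳ (h u)))
  chain-boundary {v = v} {a ∷ as} (refl ∷ walk) h = begin
    ℤΣ.sum (λ s → h (vert s) * ((δ s a - δ s (α a)) + chain as s))
      ≡⟨ ℤΣ.sum-cong-≗ {d} (λ s → distrib (h (vert s)) (δ s a) (δ s (α a)) (chain as s)) ⟩
    ℤΣ.sum (λ s → h (vert s) * δ s a + (- 1ℤ * (h (vert s) * δ s (α a)) + h (vert s) * chain as s))
      ≡⟨ ℤΣ.∑-distrib-+ {d} (λ s → h (vert s) * δ s a)
           (λ s → - 1ℤ * (h (vert s) * δ s (α a)) + h (vert s) * chain as s) ⟩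
    ℤΣ.sum (λ s → h (vert s) * δ s a)
      + ℤΣ.sum (λ s → - 1ℤ * (h (vert s) * δ s (α a)) + h (vert s) * chain as s)
      ≡⟨ cong₂ _+_ (sum-δ (h ∘ vert) a)
           (trans (ℤΣ.∑-distrib-+ {d} (λ s → - 1ℤ * (h (vert s) * δ s (α a))) (λ s → h (vert s) * chain as s))
             (cong₂ _+_
               (trans (sym (ℤΣ.*-distribˡ-sum {d} (- 1ℤ) (λ s → h (vert s) * δ s (α a))))
                 (cong (- 1ℤ *_) (sum-δ (h ∘ vert) (α a))))
               (chain-boundary walk h))) ⟩
    h (vert a) + (- 1ℤ * h (hd a) + (h (hd a) - h v))
      ≡⟨ telescope (h (vert a)) (h (hd a)) (h v) ⟩
    h (vert a) - h v ∎
    where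
    open ≡-Reasoning
    distrib : ∀ k x y z → k * ((x - y) + z) ≡ k * x + (- 1ℤ * (k * y) + k * z)
    distrib = solve-∀
    telescope : ∀ x y z → x + (- 1ℤ * y + (y - z)) ≡ x - z
    telescope = solve-∀

  chain-cycle : ∀ {u as} → Walk u as u → IsCycle P (chain as)
  chain-cycle {u} {as} walk = record
    { antisym = chain-antisym as
    ; closed  = λ h → trans (chain-boundary walk h) (ℤ.+-inverseʳ (h u))
    }

  chain-off : ∀ {as s} → All (λ a → s ≢ a × s ≢ α a) as → chain as s ≡ 0ℤ
  chain-off []                     = refl
  chain-off ((s≢a , s≢αa) ∷ off) rewrite δ-≢ s≢a | δ-≢ s≢αa | chain-off off = refl

  off-vertex : ∀ {as u} → All (λ a → u ≢ vert a × u ≢ hd a) as → ∀ s → vert s ≡ u → chain as s ≡ 0ℤ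
  off-vertex off s refl = chain-off (All.map
    (λ (≢vert , ≢head) → (≢vert ∘ cong vert) , (≢head ∘ cong vert)) off)

  -- Turning `suc k` times from `p` falls short of a full rotation, so the darts swept form a proper
  -- sector.
  NoWrap : Fin d → ℕ → Set
  NoWrap p k = ∀ i → i ≤ k → iter σ (suc i) p ≢ p

  -- Take the least number of turns that reaches `q`: a return to `p` on the way could be cut out.
  first-hit : ∀ {p q} → vert p ≡ vert q → p ≢ q → ∃ λ k → iter σ (suc k) p ≡ q × NoWrap p k
  first-hit {p} {q} same p≢q with vert-orbit p q same
  ... | l , hit with least (λ k → iter σ k p Fin.≟ q) l hit
  ... | zero  , p≡q , _     = contradiction p≡q p≢q
  ... | suc k , hit , below = k , hit , λ i i≤k wrap →
    below (k ℕ.∸ i) (s≤s (ℕ.m∸n≤m k i)) (begin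
      iter σ (k ℕ.∸ i) p                   ≡⟨ cong (iter σ (k ℕ.∸ i)) wrap ⟨
      iter σ (k ℕ.∸ i) (iter σ (suc i) p)  ≡⟨ iter-+ σ (k ℕ.∸ i) (suc i) p ⟨
      iter σ (k ℕ.∸ i ℕ.+ suc i) p
        ≡⟨ cong (λ l → iter σ l p) (trans (ℕ.+-suc (k ℕ.∸ i) i) (cong suc (ℕ.m∸n+n≡m i≤k))) ⟩
      iter σ (suc k) p                     ≡⟨ hit ⟩
      q                                    ∎)
    where open ≡-Reasoning

  no-wrap-distinct : ∀ {p k} → NoWrap p k → ∀ {i j} → i < j → j ≤ suc k → iter σ i p ≢ iter σ j p
  no-wrap-distinct {p} {k} nw {i} {j} i<j j≤ eq = nw (j ℕ.∸ suc i)
    (ℕ.≤-trans (ℕ.∸-monoˡ-≤ (suc i) j≤) (ℕ.m∸n≤m k i))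
    (sym (iter-injective σ σ-injective i (trans eq (trans (cong (λ l → iter σ l p) j≡)
      (iter-+ σ i (suc (j ℕ.∸ suc i)) p)))))
    where
    j≡ : j ≡ i ℕ.+ suc (j ℕ.∸ suc i)
    j≡ = trans (sym (ℕ.m+[n∸m]≡n i<j)) (sym (ℕ.+-suc i (j ℕ.∸ suc i)))

  -- Z passes through the vertex of p once, leaving along p and arriving along q.
  record Passes (Z : Fin d → ℤ) (p q : Fin d) : Set where
    field
      leaves  : Z p ≡ 1ℤ
      arrives : Z q ≡ - 1ℤ
      others  : ∀ s → vert s ≡ vert p → s ≢ p → s ≢ q → Z s ≡ 0ℤ

  module Colored {Z : Fin d → ℤ} (C : Coloring P Z) where
    open Coloring C public

    color-uncrossed : ∀ {s} → Z s ≡ 0ℤ → color (α s) ≡ color s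
    color-uncrossed {s} Zs≡0 = trans (color-α s)
      (trans (cong (λ z → color s + step * z) Zs≡0)
        (trans (cong (λ z → color s + z) (ℤ.*-zeroʳ step)) (ℤ.+-identityʳ _)))

    color-σ-uncrossed : ∀ {s} → Z s ≡ 0ℤ → color (σ s) ≡ color s
    color-σ-uncrossed {s} Zs≡0 = trans (trans (color-σ s) (sym (color-α s))) (color-uncrossed Zs≡0)

    color-around : ∀ {u} → (∀ s → vert s ≡ u → Z s ≡ 0ℤ) →
      ∀ {s t} → vert s ≡ u → vert t ≡ u → color t ≡ color s
    color-around {u} off {s} {t} s∈u t∈u with vert-orbit s t (trans s∈u (sym t∈u))
    ... | k , refl = go k
      where
      go : ∀ k → color (iter σ k s) ≡ color s
      go zero    = refl
      go (suc k) = trans (color-σ-uncrossed (off _ (trans (vert-iter k s) s∈u))) (go k)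

    color-across : ∀ {s} → (∀ t → vert t ≡ hd s → Z t ≡ 0ℤ) → color s ≡ color (α s)
    color-across {s} off = trans (cong color (sym (α-invol s))) (color-uncrossed (off (α s) refl))

    color-step≢ : ∀ x → x + step ≢ x
    color-step≢ x p = step≢0 (trans (cancel x step) (trans (cong (λ y → y - x) p) (ℤ.+-inverseʳ x)))
      where
      cancel : ∀ x y → y ≡ (x + y) - x
      cancel = solve-∀

    color-leave : ∀ {s} → Z s ≡ 1ℤ → color (σ s) ≡ color s + step
    color-leave {s} Zs≡1 = trans (color-σ s)
      (cong (λ z → color s + z) (trans (cong (step *_) Zs≡1) (ℤ.*-identityʳ step)))

    module _ {p k} (nw : NoWrap p k) (passes : Passes Z p (iter σ (suc k) p)) where
      open Passes passes

      -- The colour rises by `step` on turning past `p` and no further dart of the cycle is passed.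
      -- The last dart of the sector still has the inner colour, because its edge is crossed only on
      -- turning past it.
      color-sector : ∀ i → i ≤ k → color (iter σ (suc i) p) ≡ color p + step
      color-sector zero    _   = color-leave leaves
      color-sector (suc i) i<k = trans
        (color-σ-uncrossed (others _ (vert-iter (suc i) p) (nw i (ℕ.<⇒≤ i<k))
          (no-wrap-distinct nw (s≤s i<k) ℕ.≤-refl)))
        (color-sector i (ℕ.<⇒≤ i<k))

      color-after : color (iter σ (suc (suc k)) p) ≡ color p
      color-after = trans (color-σ _) (trans
        (cong₂ (λ x z → x + step * z) (color-sector k ℕ.≤-refl) arrives)
        (cancel (color p) step))
        where
        cancel : ∀ x y → (x + y) + y * - 1ℤ ≡ x
        cancel = solve-∀

      -- Follow the rotation from `p` to `s`: on leaving the sector the colour falls back by `step`,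
      -- and it rises again only past `p`.
      sector-or-color≡ : ∀ s → vert p ≡ vert s →
        (∃ λ i → i ≤ k × s ≡ iter σ (suc i) p) ⊎ color s ≡ color p
      sector-or-color≡ s same with vert-orbit p s same
      ... | l , refl = go l
        where
        go : ∀ l → (∃ λ i → i ≤ k × iter σ l p ≡ iter σ (suc i) p) ⊎ color (iter σ l p) ≡ color p
        go zero = inj₂ refl
        go (suc l) with go l
        ... | inj₁ (i , i≤k , eq) with ℕ.m≤n⇒m<n∨m≡n i≤k
        ...   | inj₁ i<k  = inj₁ (suc i , i<k , cong σ eq)
        ...   | inj₂ refl = inj₂ (trans (cong (color ∘ σ) eq) color-after)
        go (suc l) | inj₂ eq with iter σ l p Fin.≟ p | iter σ l p Fin.≟ iter σ (suc k) p
        ... | yes l≡p | _       = inj₁ (0 , z≤n , cong σ l≡p)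
        ... | no  _   | yes l≡q = inj₂ (trans (cong (color ∘ σ) l≡q) color-after)
        ... | no  l≢p | no  l≢q = inj₂ (trans (color-σ-uncrossed (others _ (vert-iter l p) l≢p l≢q)) eq)

  -- Adjacency and degrees

  adj-dart : ∀ s → Adj P (vert s) (hd s)
  adj-dart s = s , refl , refl

  adj-sym : ∀ {u v} → Adj P u v → Adj P v u
  adj-sym (x , p , q) = α x , q , trans (head-α x) p

  adj-irrefl : ∀ {u} → ¬ Adj P u u
  adj-irrefl (x , p , q) = no-loop x (trans q (sym p))

  adj? : ∀ u v → Dec (Adj P u v)
  adj? u v = Fin.any? (λ x → (vert x Fin.≟ u) ×-dec (hd x Fin.≟ v))

  -- `α s`, `σ s` and `φ (σ s)` are the three darts of one face, so the last ends where the first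
  -- starts.
  head-φσ : ∀ s → hd (φ P (σ s)) ≡ hd s
  head-φσ s = begin
    hd (φ P (σ s))               ≡⟨ vert-σ _ ⟨
    vert (φ P (φ P (σ s)))       ≡⟨ cong (vert ∘ φ P ∘ φ P) (φα P s) ⟨
    vert (φ P (φ P (φ P (α s)))) ≡⟨ cong vert (face-tri₃ (α s)) ⟩
    hd s                         ∎
    where open ≡-Reasoning

  adj-consecutive : ∀ s → Adj P (hd s) (hd (σ s))
  adj-consecutive s = adj-sym (φ P (σ s) , vert-σ _ , head-φσ s)

  -- A vertex of degree two forces the triangulation to be a single 3-cycle.
  degree≥3 : ∀ {a c} → a ≢ c → ¬ Adj P a c → ∀ p → σ (σ p) ≢ p
  degree≥3 {a} {c} a≢c nadj p σσp≡p = impossible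
    where
    E E′ : Fin d
    E  = σ (α (σ p))
    E′ = σ (α p)
    φφE : σ (α E) ≡ α p
    φφE = trans (cong (φ P ∘ φ P) (sym (φα P p))) (face-tri₃ (α p))
    φφE′ : σ (α E′) ≡ α (σ p)
    φφE′ = trans (cong (φ P ∘ φ P) (sym (trans (φα P (σ p)) σσp≡p))) (face-tri₃ (α (σ p)))
    -- Each of the two faces at `vert p` has an edge joining `hd p` and `hd (σ p)`. By simplicity it
    -- is the same edge, so six darts are closed under `σ` and `α`.
    αE≡E′ : α E ≡ E′
    αE≡E′ = no-multi (α E) E′
      (trans (head-φσ p) (sym (vert-σ (α p))))
      (trans (head-α E) (trans (vert-σ (α (σ p))) (trans (cong vert (sym φφE′)) (vert-σ (α E′)))))
    Six : Fin d → Set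
    Six y = (y ≡ p ⊎ y ≡ σ p) ⊎ (y ≡ α p ⊎ y ≡ E′) ⊎ (y ≡ α (σ p) ⊎ y ≡ E)
    six : ∀ {y} → Reach σ α p y → Six y
    six here = inj₁ (inj₁ refl)
    six (stepσ r) with six r
    ... | inj₁ (inj₁ refl)        = inj₁ (inj₂ refl)
    ... | inj₁ (inj₂ refl)        = inj₁ (inj₁ σσp≡p)
    ... | inj₂ (inj₁ (inj₁ refl)) = inj₂ (inj₁ (inj₂ refl))
    ... | inj₂ (inj₁ (inj₂ refl)) = inj₂ (inj₁ (inj₁ (trans (cong σ (sym αE≡E′)) φφE)))
    ... | inj₂ (inj₂ (inj₁ refl)) = inj₂ (inj₂ (inj₂ refl))
    ... | inj₂ (inj₂ (inj₂ refl)) =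
      inj₂ (inj₂ (inj₁ (trans (cong σ (trans (sym (α-invol E)) (cong α αE≡E′))) φφE′)))
    six (stepα r) with six r
    ... | inj₁ (inj₁ refl)        = inj₂ (inj₁ (inj₁ refl))
    ... | inj₁ (inj₂ refl)        = inj₂ (inj₂ (inj₁ refl))
    ... | inj₂ (inj₁ (inj₁ refl)) = inj₁ (inj₁ (α-invol p))
    ... | inj₂ (inj₁ (inj₂ refl)) = inj₂ (inj₂ (inj₂ (trans (cong α (sym αE≡E′)) (α-invol E))))
    ... | inj₂ (inj₂ (inj₁ refl)) = inj₁ (inj₂ (α-invol (σ p)))
    ... | inj₂ (inj₂ (inj₂ refl)) = inj₂ (inj₁ (inj₂ αE≡E′))
    Three : Fin n → Set
    Three u = u ≡ vert p ⊎ u ≡ hd p ⊎ u ≡ hd (σ p)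
    three : ∀ u → Three u
    three u with vert-surj u
    ... | y , refl with six (connected p y)
    ... | inj₁ (inj₁ refl)        = inj₁ refl
    ... | inj₁ (inj₂ refl)        = inj₁ (vert-σ p)
    ... | inj₂ (inj₁ (inj₁ refl)) = inj₂ (inj₁ refl)
    ... | inj₂ (inj₁ (inj₂ refl)) = inj₂ (inj₁ (vert-σ _))
    ... | inj₂ (inj₂ (inj₁ refl)) = inj₂ (inj₂ refl)
    ... | inj₂ (inj₂ (inj₂ refl)) = inj₂ (inj₂ (vert-σ _))
    adj₁ : Adj P (vert p) (hd p)
    adj₁ = adj-dart p
    adj₂ : Adj P (vert p) (hd (σ p))
    adj₂ = σ p , vert-σ p , refl
    adj₃ : Adj P (hd p) (hd (σ p))
    adj₃ = adj-consecutive p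
    impossible : ⊥
    impossible with three a | three c
    ... | inj₁ refl        | inj₁ refl        = a≢c refl
    ... | inj₁ refl        | inj₂ (inj₁ refl) = nadj adj₁
    ... | inj₁ refl        | inj₂ (inj₂ refl) = nadj adj₂
    ... | inj₂ (inj₁ refl) | inj₁ refl        = nadj (adj-sym adj₁)
    ... | inj₂ (inj₁ refl) | inj₂ (inj₁ refl) = a≢c refl
    ... | inj₂ (inj₁ refl) | inj₂ (inj₂ refl) = nadj adj₃
    ... | inj₂ (inj₂ refl) | inj₁ refl        = nadj (adj-sym adj₂)
    ... | inj₂ (inj₂ refl) | inj₂ (inj₁ refl) = nadj (adj-sym adj₃)
    ... | inj₂ (inj₂ refl) | inj₂ (inj₂ refl) = a≢c refl

  -- Separation by 3-cycles

  module Triangle {p g h : Fin d} (vert-h : vert h ≡ vert p)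
    (vert-g : vert g ≡ hd p) (head-g : hd g ≡ hd h) (p≢h : p ≢ h) where

    triangle : List (Fin d)
    triangle = p ∷ g ∷ α h ∷ []

    triangle-coloring : Coloring P (chain triangle)
    triangle-coloring = cycle-coloring P (chain-cycle {u = vert p}
      (refl ∷ vert-g ∷ sym head-g ∷ subst (λ u → Walk u [] (vert p)) (sym (trans (head-α h) vert-h)) []))

    open Colored triangle-coloring public

    off-triangle : ∀ {u} → u ≢ vert p → u ≢ hd p → u ≢ hd h →
      ∀ s → vert s ≡ u → chain triangle s ≡ 0ℤ
    off-triangle ≢v ≢p ≢h = off-vertex
      ( (≢v , ≢p)
      ∷ ((λ e → ≢p (trans e vert-g)) , (λ e → ≢h (trans e head-g)))
      ∷ (≢h , (λ e → ≢v (trans e (trans (head-α h) vert-h))))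
      ∷ [])

    private
      v≢hd : ∀ {s t} → vert s ≡ vert p → vert t ≡ vert p → s ≢ α t
      v≢hd {t = t} sv tv s≡αt = no-loop t (trans (sym (cong vert s≡αt)) (trans sv (sym tv)))

      ≢g : ∀ {s} → vert s ≡ vert p → s ≢ g
      ≢g sv s≡g = no-loop p (trans (sym vert-g) (trans (sym (cong vert s≡g)) sv))

      ≢αg : ∀ {s} → vert s ≡ vert p → s ≢ α g
      ≢αg sv s≡αg = no-loop h (trans (trans (sym head-g) (trans (sym (cong vert s≡αg)) sv)) (sym vert-h))

      off-αα : ∀ {s} → s ≢ h → s ≢ α (α h)
      off-αα s≢h e = s≢h (trans e (α-invol h))

    triangle-passes : Passes (chain triangle) p h
    triangle-passes = record
      { leaves  = begin
          (δ p p - δ p (α p)) + chain (g ∷ α h ∷ []) p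
            ≡⟨ cong₂ (λ z z′ → (z - z′) + chain (g ∷ α h ∷ []) p) (δ-≡ p) (δ-≢ (v≢hd refl refl)) ⟩
          1ℤ + chain (g ∷ α h ∷ []) p
            ≡⟨ cong (λ z → 1ℤ + z) (chain-off
                 ((≢g refl , ≢αg refl) ∷ (v≢hd refl vert-h , off-αα p≢h) ∷ [])) ⟩
          1ℤ ∎
      ; arrives = begin
          chain triangle h
            ≡⟨ cong₂ _+_ (cong₂ _-_ (δ-≢ (p≢h ∘ sym)) (δ-≢ (v≢hd vert-h refl)))
                 (cong₂ _+_ (cong₂ _-_ (δ-≢ (≢g vert-h)) (δ-≢ (≢αg vert-h)))
                   (cong₂ _+_ (cong₂ _-_ (δ-≢ (v≢hd vert-h vert-h))
                     (trans (cong (δ h) (α-invol h)) (δ-≡ h))) refl)) ⟩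
          - 1ℤ ∎
      ; others  = λ s sv s≢p s≢h → chain-off
          ((s≢p , v≢hd sv refl) ∷ (≢g sv , ≢αg sv) ∷ (v≢hd sv vert-h , off-αα s≢h) ∷ [])
      }
      where open ≡-Reasoning

  -- Chords of the link of a vertex do not cross, so some link vertex lies on no chord:
  -- below any chord there is a strictly shorter one.
  module Link (v : Fin n)
    (chord : ∀ p → vert p ≡ v → ∃ λ q → vert q ≡ v × q ≢ p × q ≢ σ p × σ q ≢ p × Adj P (hd p) (hd q)) where

    -- The 3-cycle through `p`, the chord `g` and the end of the sector cannot be crossed by the
    -- chord at `σ p`. That chord therefore ends within the sector and spans a smaller one starting
    -- at `σ p`. `B` bounds the induction; `k = 0` is excluded because consecutive link vertices are
    -- always adjacent.
    no-chord : ∀ B k → k ≤ B → 1 ≤ k → ∀ p → vert p ≡ v → NoWrap p k →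
      ¬ Adj P (hd p) (hd (iter σ (suc k) p))
    no-chord zero    k k≤0 1≤k = contradiction (ℕ.≤-trans 1≤k k≤0) λ ()
    no-chord (suc B) k k≤B 1≤k p p∈v nw (g , vert-g , head-g)
      with chord (σ p) (trans (vert-σ p) p∈v)
    ... | q , q∈v , q≢σp , q≢σσp , σq≢σp , (e , vert-e , head-e) = conclude
      where
      h = iter σ (suc k) p
      open Triangle {p} {g} {h} (vert-iter (suc k) p) vert-g head-g (nw k ℕ.≤-refl ∘ sym)

      off : ∀ {s} → vert s ≡ v → s ≢ p → s ≢ h → ∀ t → vert t ≡ hd s → chain triangle t ≡ 0ℤ
      off {s} s∈v s≢p s≢h = off-triangle
        (λ eq → no-loop s (trans eq (trans p∈v (sym s∈v))))
        (λ eq → s≢p (no-multi _ _ (trans s∈v (sym p∈v)) eq))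
        (λ eq → s≢h (no-multi _ _ (trans s∈v (trans (sym p∈v) (sym (vert-iter (suc k) p)))) eq))

      σp∈v : vert (σ p) ≡ v
      σp∈v = trans (vert-σ p) p∈v

      off-σp = off σp∈v (nw 0 z≤n) (no-wrap-distinct nw (s≤s 1≤k) ℕ.≤-refl)

      -- Go from `σ p` to its head, along the chord `e` and back to `q`: none of these edges lies on
      -- the 3-cycle.
      same-side : q ≢ h → color q ≡ color (σ p)
      same-side q≢h = begin
        color q       ≡⟨ color-across off-q ⟩
        color (α q)   ≡⟨ color-around off-q head-e refl ⟩
        color (α e)   ≡⟨ color-uncrossed (off-σp e vert-e) ⟩
        color e       ≡⟨ color-around off-σp refl vert-e ⟩
        color (α (σ p)) ≡⟨ color-across off-σp ⟨
        color (σ p)   ∎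
        where
        open ≡-Reasoning
        off-q = off q∈v (σq≢σp ∘ cong σ) q≢h

      shorter : ∀ i → i ≤ k → q ≡ iter σ (suc i) p → ⊥
      shorter zero          _   q≡ = q≢σp q≡
      shorter (suc zero)    _   q≡ = q≢σσp q≡
      shorter (suc (suc i)) i<k q≡ = no-chord B (suc i) (ℕ.s≤s⁻¹ (ℕ.≤-trans i<k k≤B)) (s≤s z≤n)
        (σ p) σp∈v
        (λ j j≤i wrap → nw j (ℕ.≤-trans j≤i (ℕ.<⇒≤ i<k))
          (σ-injective (trans (sym (cong σ (iter-suc σ j p))) wrap)))
        (e , vert-e , trans head-e (cong hd (trans q≡ (sym (iter-suc σ (suc (suc i)) p)))))

      conclude : ⊥
      conclude with sector-or-color≡ nw triangle-passes q (trans p∈v (sym q∈v)) | q Fin.≟ h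
      ... | inj₁ (i , i≤k , q≡) | _       = shorter i i≤k q≡
      ... | inj₂ _              | yes q≡h = shorter k ℕ.≤-refl q≡h
      ... | inj₂ q≡p            | no q≢h  = color-step≢ (color p)
        (trans (sym (color-sector nw triangle-passes 0 z≤n)) (trans (sym (same-side q≢h)) q≡p))

    impossible : ⊥
    impossible with vert-surj v
    ... | p , p∈v with chord p p∈v
    ... | q , q∈v , q≢p , q≢σp , _ , adj with first-hit (trans p∈v (sym q∈v)) (q≢p ∘ sym)
    ... | zero  , hit , _  = q≢σp (sym hit)
    ... | suc k , hit , nw = no-chord (suc k) (suc k) ℕ.≤-refl (s≤s z≤n) p p∈v nw
      (subst (Adj P (hd p)) (cong hd (sym hit)) adj)

  -- Irreducibility and visible braces

  module Irred {b : ℕ} (B : Braces P b) (irr : Irreducible P B) where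
    open Braces B

    BraceEnd : Fin n → Set
    BraceEnd u = ∃ λ i → u ≡ proj₁ (brace i) ⊎ u ≡ proj₂ (brace i)

    braceEnd? : Decidable BraceEnd
    braceEnd? u = Fin.any? (λ i → (u Fin.≟ proj₁ (brace i)) ⊎-dec (u Fin.≟ proj₂ (brace i)))

    isBrace-ends : ∀ {u v} → IsBrace P B u v → BraceEnd u × BraceEnd v
    isBrace-ends (i , inj₁ eq) =
      (i , inj₁ (cong proj₁ (sym eq))) , (i , inj₂ (cong proj₂ (sym eq)))
    isBrace-ends (i , inj₂ eq) =
      (i , inj₂ (cong proj₂ (sym eq))) , (i , inj₁ (cong proj₁ (sym eq)))

    adjG⇒adj : ∀ {u v} → ¬ BraceEnd u → AdjG P B u v → Adj P u v
    adjG⇒adj _  (inj₁ adj) = adj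
    adjG⇒adj ¬u (inj₂ br)  = contradiction (proj₁ (isBrace-ends br)) ¬u

    commonNbr? : ∀ u v w → Dec (CommonNbr P u v w)
    commonNbr? u v w = ¬? (w Fin.≟ u) ×-dec ¬? (w Fin.≟ v) ×-dec adj? u w ×-dec adj? v w

    -- By irreducibility an edge in no braced triangle is not contractible in `P`, so its ends do
    -- not have exactly two common neighbours.
    third-common-neighbour : ∀ {u v w₁ w₂} → Adj P u v → ¬ InBracedTriangle P B u v →
      w₁ ≢ w₂ → CommonNbr P u v w₁ → CommonNbr P u v w₂ →
      ∃ λ w → CommonNbr P u v w × w ≢ w₁ × w ≢ w₂
    third-common-neighbour {u} {v} {w₁} {w₂} adj unbraced w₁≢w₂ c₁ c₂
      with Fin.any? (λ w → commonNbr? u v w ×-dec ¬? (w Fin.≟ w₁) ×-dec ¬? (w Fin.≟ w₂))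
    ... | yes third = third
    ... | no ∄ = contradiction ((w₁ , w₂ , w₁≢w₂ , c₁ , c₂ , only) , unbraced) (irr u v adj)
      where
      only : ∀ w → CommonNbr P u v w → w ≡ w₁ ⊎ w ≡ w₂
      only w c with w Fin.≟ w₁ | w Fin.≟ w₂
      ... | yes w≡w₁ | _        = inj₁ w≡w₁
      ... | no _     | yes w≡w₂ = inj₂ w≡w₂
      ... | no w≢w₁  | no w≢w₂  = contradiction (w , c , w≢w₁ , w≢w₂) ∄

    common-neighbour : ∀ {u v w} → Adj P u w → Adj P v w → CommonNbr P u v w
    common-neighbour {u} {v} uw vw =
      (λ { refl → adj-irrefl uw }) , (λ { refl → adj-irrefl vw }) , uw , vw

    AdjBoth : Fin n → Fin b → Set
    AdjBoth u i = Adj P u (proj₁ (brace i)) × Adj P u (proj₂ (brace i))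

    adjBoth? : ∀ u → Decidable (AdjBoth u)
    adjBoth? u i = adj? u (proj₁ (brace i)) ×-dec adj? u (proj₂ (brace i))

    σσ≢ : Fin b → ∀ p → σ (σ p) ≢ p
    σσ≢ i₀ = degree≥3 (brace-ne i₀) (brace-nadj i₀)

    -- In a braced triangle at `v` the brace must be the side opposite `v`, since `v` is no brace
    -- end. If `v` sees no brace, every link vertex therefore has a third common neighbour with `v`,
    -- which gives a chord of the link.
    sees-brace : Fin b → ∀ {v} → ¬ BraceEnd v → ∃ (AdjBoth v)
    sees-brace i₀ {v} ¬end with Fin.any? (adjBoth? v)
    ... | yes found = found
    ... | no ∄ = ⊥-elim (Link.impossible v chord)
      where
      unbraced : ∀ {u} → Adj P v u → ¬ InBracedTriangle P B v u
      unbraced vu (w , _ , _ , vw , uw , inj₁ br)        = ¬end (proj₁ (isBrace-ends br))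
      unbraced vu (w , _ , _ , vw , uw , inj₂ (inj₁ br)) = ¬end (proj₁ (isBrace-ends br))
      unbraced vu (w , _ , _ , vw , uw , inj₂ (inj₂ (i , inj₁ eq))) =
        ∄ (i , subst (λ e → Adj P v (proj₁ e) × Adj P v (proj₂ e)) (sym eq) (vu , adjG⇒adj ¬end vw))
      unbraced vu (w , _ , _ , vw , uw , inj₂ (inj₂ (i , inj₂ eq))) =
        ∄ (i , subst (λ e → Adj P v (proj₁ e) × Adj P v (proj₂ e)) (sym eq) (adjG⇒adj ¬end vw , vu))

      chord : ∀ p → vert p ≡ v → ∃ λ q → vert q ≡ v × q ≢ p × q ≢ σ p × σ q ≢ p × Adj P (hd p) (hd q)
      -- The two faces at the edge give the common neighbours `hd (σ p)` and `hd (σ⁻¹ p)`, which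
      -- differ because the degree of `v` is not two.
      chord p refl with third-common-neighbour (adj-dart p) (unbraced (adj-dart p))
        (λ eq → σσ≢ i₀ p (trans (cong σ (no-multi (σ p) (σ⁻¹ p)
          (trans (vert-σ p) (trans (cong vert (sym (σσ⁻¹ p))) (vert-σ (σ⁻¹ p)))) eq)) (σσ⁻¹ p)))
        (common-neighbour (σ p , vert-σ p , refl) (adj-consecutive p))
        (common-neighbour
          (σ⁻¹ p , trans (sym (vert-σ (σ⁻¹ p))) (cong vert (σσ⁻¹ p)) , refl)
          (adj-sym (subst (Adj P (hd (σ⁻¹ p))) (cong hd (σσ⁻¹ p)) (adj-consecutive (σ⁻¹ p)))))
      ... | w , (_ , w≢hp , (q , q∈v , refl) , uw) , ≢σp , ≢σ⁻¹p =
        q , q∈v , w≢hp ∘ cong hd , ≢σp ∘ cong hd ,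
        (λ σq≡p → ≢σ⁻¹p (cong hd (trans (sym (σ⁻¹σ q)) (cong σ⁻¹ σq≡p)))) , uw

-- Common neighbours of the ends of a brace

-- Otherwise each index would be `i`, `j` or the one with value `z`, and `code` would inject `Fin k`
-- into `Fin 3`.
fourth-index : ∀ {A : Set} → (∀ (x y : A) → Dec (x ≡ y)) → ∀ {k} (κ : Fin k → A) →
  (∀ {i j} → κ i ≡ κ j → i ≡ j) → 4 ≤ k → ∀ i j z → ∃ λ l → l ≢ i × l ≢ j × κ l ≢ z
fourth-index _≟_ {k} κ κ-inj 4≤k i j z
  with Fin.any? (λ l → ¬? (l Fin.≟ i) ×-dec ¬? (l Fin.≟ j) ×-dec ¬? (κ l ≟ z))
... | yes found = found
... | no ∄ = contradiction (Fin.injective⇒≤ (λ {l} {l′} → code-inj l l′)) (ℕ.<⇒≱ 4≤k)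
  where
  code : Fin k → Fin 3
  code l with l Fin.≟ i | l Fin.≟ j
  ... | yes _ | _     = zero
  ... | no _  | yes _ = suc zero
  ... | no _  | no _  = suc (suc zero)
  code-inj : ∀ l l′ → code l ≡ code l′ → l ≡ l′
  code-inj l l′ eq with l Fin.≟ i | l Fin.≟ j | l′ Fin.≟ i | l′ Fin.≟ j
  code-inj l l′ eq | yes refl | _        | yes refl | _        = refl
  code-inj l l′ eq | no _     | yes refl | no _     | yes refl = refl
  code-inj l l′ eq | no l≢i   | no l≢j   | no l′≢i  | no l′≢j  = κ-inj (trans (≡z l≢i l≢j) (sym (≡z l′≢i l′≢j)))
    where
    ≡z : ∀ {l} → l ≢ i → l ≢ j → κ l ≡ z
    ≡z {l} l≢i l≢j = decidable-stable (κ l ≟ z) (λ ≢z → ∄ (l , l≢i , l≢j , ≢z))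
  code-inj l l′ () | yes _    | _        | no _     | yes _
  code-inj l l′ () | yes _    | _        | no _     | no _
  code-inj l l′ () | no _     | yes _    | yes _    | _
  code-inj l l′ () | no _     | no _     | yes _    | _
  code-inj l l′ () | no _     | yes _    | no _     | no _
  code-inj l l′ () | no _     | no _     | no _     | yes _

lookup-injective : ∀ {A : Set} {xs : List A} → Unique xs → ∀ {i j} → lookup xs i ≡ lookup xs j → i ≡ j
lookup-injective (_    ∷ _)   {zero}  {zero}  _  = refl
lookup-injective (x∉xs ∷ _)   {zero}  {suc j} eq = contradiction eq (All.lookup x∉xs (∈-lookup j))
lookup-injective (x∉xs ∷ _)   {suc i} {zero}  eq = contradiction (sym eq) (All.lookup x∉xs (∈-lookup i))
lookup-injective (_    ∷ xs!) {suc i} {suc j} eq = cong suc (lookup-injective xs! eq)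

length-concat-tabulate : ∀ {A : Set} {b M} (g : Fin b → List A) → (∀ i → length (g i) ≤ M) →
  length (concat (tabulate g)) ≤ b ℕ.* M
length-concat-tabulate {b = zero}      g g≤ = z≤n
length-concat-tabulate {b = suc b} {M} g g≤ = subst (ℕ._≤ M ℕ.+ b ℕ.* M)
  (sym (List.length-++ (g zero)))
  (ℕ.+-mono-≤ (g≤ zero) (length-concat-tabulate (g ∘ suc) (g≤ ∘ suc)))

covering-length : ∀ {n} (xs : List (Fin n)) → (∀ v → v ∈ xs) → n ≤ length xs
covering-length xs cover = Fin.injective⇒≤ {f = λ v → index (cover v)} λ {u} {v} eq →
  trans (lookup-index (cover u)) (trans (cong (lookup xs) eq) (sym (lookup-index (cover v))))

-- Separation by 4-cycles

module _ {n : ℕ} (P : SphereTriangulation n) where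
  open SphereTriangulation P

  private
    h : Fin d → Fin n
    h = head P

  module Quadrilateral {p₁ q₁ p₂ q₂ : Fin d} (vert-p : vert p₂ ≡ vert p₁) (vert-q : vert q₂ ≡ vert q₁)
    (head₁ : h q₁ ≡ h p₁) (head₂ : h q₂ ≡ h p₂) where

    quadrilateral : List (Fin d)
    quadrilateral = p₁ ∷ α q₁ ∷ q₂ ∷ α p₂ ∷ []

    quadrilateral-coloring : Coloring P (chain P quadrilateral)
    quadrilateral-coloring = cycle-coloring P (chain-cycle P {u = vert p₁}
      (refl ∷ head₁ ∷ trans vert-q (sym (head-α P q₁)) ∷ sym head₂ ∷
        subst (λ u → Walk P u [] (vert p₁)) (sym (trans (head-α P p₂) vert-p)) []))

    off-quadrilateral : ∀ {u} → u ≢ vert p₁ → u ≢ vert q₁ → u ≢ h p₁ → u ≢ h p₂ →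
      ∀ s → vert s ≡ u → chain P quadrilateral s ≡ 0ℤ
    off-quadrilateral ≢x ≢y ≢h₁ ≢h₂ = off-vertex P
      ( (≢x , ≢h₁)
      ∷ ((λ e → ≢h₁ (trans e head₁)) , (λ e → ≢y (trans e (head-α P q₁))))
      ∷ ((λ e → ≢y (trans e vert-q)) , (λ e → ≢h₂ (trans e head₂)))
      ∷ (≢h₂ , (λ e → ≢x (trans e (trans (head-α P p₂) vert-p))))
      ∷ [])

    -- Every edge of the 4-cycle ends at `vert p₁` or `vert q₁`. This applies to an edge joining two
    -- common neighbours.
    off-edge : ∀ {s} → vert s ≢ vert p₁ → vert s ≢ vert q₁ → h s ≢ vert p₁ → h s ≢ vert q₁ →
      chain P quadrilateral s ≡ 0ℤ
    off-edge {s} vs≢x vs≢y hs≢x hs≢y = chain-off P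
      ( (vs≢x ∘ cong vert , back hs≢x)
      ∷ (back hs≢y , (λ e → vs≢y (trans (cong vert e) (head-α P q₁))))
      ∷ ((λ e → vs≢y (trans (cong vert e) vert-q)) , back (λ e → hs≢y (trans e vert-q)))
      ∷ (back (λ e → hs≢x (trans e vert-p)) , (λ e → vs≢x (trans (cong vert e) (trans (head-α P p₂) vert-p))))
      ∷ [])
      where
      back : ∀ {a} → h s ≢ vert a → s ≢ α a
      back {a} ≢a e = ≢a (trans (cong h e) (head-α P a))

    quadrilateral-passes : p₁ ≢ p₂ → vert p₁ ≢ vert q₁ → Passes P (chain P quadrilateral) p₁ p₂
    quadrilateral-passes p₁≢p₂ x≢y = record
      { leaves  = cong₂ _+_ (cong₂ _-_ (δ-≡ p₁) (δ-≢ (≢α refl refl)))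
          (chain-off P (All.++⁺ (offs refl) ((≢α refl vert-p , p₁≢p₂ ∘ (λ e → trans e (α-invol p₂))) ∷ [])))
      ; arrives = cong₂ _+_ (cong₂ _-_ (δ-≢ (p₁≢p₂ ∘ sym)) (δ-≢ (≢α vert-p refl)))
          (last-term (offs vert-p))
      ; others  = λ s s∈x s≢p₁ s≢p₂ → chain-off P ((s≢p₁ , ≢α s∈x refl) ∷
          (All.++⁺ (offs s∈x) ((≢α s∈x vert-p , s≢p₂ ∘ (λ e → trans e (α-invol p₂))) ∷ [])))
      }
      where
      ≢α : ∀ {s t} → vert s ≡ vert p₁ → vert t ≡ vert p₁ → s ≢ α t
      ≢α {t = t} s∈x t∈x e = no-loop t (trans (sym (cong vert e)) (trans s∈x (sym t∈x)))
      offs : ∀ {s} → vert s ≡ vert p₁ → All (λ a → s ≢ a × s ≢ α a) (α q₁ ∷ q₂ ∷ [])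
      offs s∈x =
        ( (λ e → no-loop p₁ (trans (sym head₁) (trans (sym (cong vert e)) s∈x)))
        , (λ e → x≢y (trans (sym s∈x) (trans (cong vert e) (head-α P q₁)))))
        ∷
        ( (λ e → x≢y (trans (sym s∈x) (trans (cong vert e) vert-q)))
        , (λ e → no-loop p₂ (trans (sym head₂) (trans (sym (cong vert e)) (trans s∈x (sym vert-p))))))
        ∷ []
      last-term : All (λ a → p₂ ≢ a × p₂ ≢ α a) (α q₁ ∷ q₂ ∷ []) →
        chain P (α q₁ ∷ q₂ ∷ α p₂ ∷ []) p₂ ≡ - 1ℤ
      last-term ((a , a′) ∷ (c , c′) ∷ []) =
        cong₂ _+_ (cong₂ _-_ (δ-≢ a) (δ-≢ a′)) (cong₂ _+_ (cong₂ _-_ (δ-≢ c) (δ-≢ c′))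
          (cong₂ _+_ (cong₂ _-_ (δ-≢ (≢α vert-p vert-p)) (trans (cong (δ p₂) (α-invol p₂)) (δ-≡ p₂))) refl))

  -- Regions at a brace

  module _ {b : ℕ} (B : Braces P b) (irr : Irreducible P B) where
    open Braces B
    open Irred P B irr

    ends : Fin (b ℕ.+ b) → Fin n
    ends e = [ proj₁ ∘ brace , proj₂ ∘ brace ]′ (Fin.splitAt b e)

    braceEnd-index : ∀ {u} → BraceEnd u → ∃ λ e → ends e ≡ u
    braceEnd-index (i , inj₁ refl) = i ↑ˡ b , cong [ proj₁ ∘ brace , proj₂ ∘ brace ]′ (Fin.splitAt-↑ˡ b i b)
    braceEnd-index (i , inj₂ refl) = b ↑ʳ i , cong [ proj₁ ∘ brace , proj₂ ∘ brace ]′ (Fin.splitAt-↑ʳ b b i)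

    module CommonNeighbours (i₀ : Fin b) {k : ℕ} (p q : Fin k → Fin d)
      (vert-p : ∀ i → vert (p i) ≡ proj₁ (brace i₀))
      (vert-q : ∀ i → vert (q i) ≡ proj₂ (brace i₀))
      (same-head : ∀ i → h (q i) ≡ h (p i))
      (κ-injective : ∀ {i j} → h (p i) ≡ h (p j) → i ≡ j)
      (κ-¬end : ∀ i → ¬ BraceEnd (h (p i)))
      (complete : ∀ {w} → ¬ BraceEnd w → AdjBoth w i₀ → ∃ λ i → h (p i) ≡ w) where

      x y : Fin n
      x = proj₁ (brace i₀)
      y = proj₂ (brace i₀)

      κ : Fin k → Fin n
      κ i = h (p i)

      x≢κ : ∀ i → x ≢ κ i
      x≢κ i e = κ-¬end i (subst BraceEnd e (i₀ , inj₁ refl))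

      y≢κ : ∀ i → y ≢ κ i
      y≢κ i e = κ-¬end i (subst BraceEnd e (i₀ , inj₂ refl))

      module Q i j = Quadrilateral {p i} {q i} {p j} {q j}
        (trans (vert-p j) (sym (vert-p i))) (trans (vert-q j) (sym (vert-q i))) (same-head i) (same-head j)

      module F i j = Colored P (Q.quadrilateral-coloring i j)

      passes : ∀ {i j} → i ≢ j → Passes P (chain P (Q.quadrilateral i j)) (p i) (p j)
      passes {i} {j} i≢j = Q.quadrilateral-passes i j (i≢j ∘ κ-injective ∘ cong h)
        (λ e → brace-ne i₀ (trans (sym (vert-p i)) (trans e (vert-q i))))

      -- The face after p i is separated from the face after p j by the 4-cycle x κᵢ y κⱼ.
      Region : Fin k → Fin d → Set
      Region i s = ∀ a c → F.color a c s ≡ F.color a c (σ (p i))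

      region? : ∀ i s → Dec (Region i s)
      region? i s = Fin.all? (λ a → Fin.all? (λ c → F.color a c s ℤ.≟ F.color a c (σ (p i))))

      -- The 4-cycle of `i` and `j` separates the two: the face of `σ (p i)` is in the sector from
      -- `p i` to `p j`, that of `σ (p j)` is just past it.
      region-disjoint : ∀ {i j s} → i ≢ j → Region i s → Region j s → ⊥
      region-disjoint {i} {j} i≢j in-i in-j
        with first-hit P {p i} {p j} (trans (vert-p i) (sym (vert-p j))) (i≢j ∘ κ-injective ∘ cong h)
      ... | l , hit , nw = F.color-step≢ i j _ (begin
        F.color i j (p i) + F.step i j  ≡⟨ F.color-sector i j nw passes′ 0 z≤n ⟨
        F.color i j (σ (p i))           ≡⟨ in-i i j ⟨
        F.color i j _                   ≡⟨ in-j i j ⟩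
        F.color i j (σ (p j))           ≡⟨ cong (F.color i j ∘ σ) hit ⟨
        F.color i j (iter σ (suc (suc l)) (p i)) ≡⟨ F.color-after i j nw passes′ ⟩
        F.color i j (p i)               ∎)
        where
        open ≡-Reasoning
        passes′ = subst (Passes P (chain P (Q.quadrilateral i j)) (p i)) (sym hit) (passes i≢j)

      -- Such a vertex lies on none of the 4-cycles, so all faces around it share their regions.
      Free : Fin n → Set
      Free w = w ≢ x × w ≢ y × (∀ j → κ j ≢ w)

      free-off : ∀ {w} → Free w → ∀ a c s → vert s ≡ w → chain P (Q.quadrilateral a c) s ≡ 0ℤ
      free-off (w≢x , w≢y , w≢κ) a c = Q.off-quadrilateral a c
        (λ e → w≢x (trans e (vert-p a))) (λ e → w≢y (trans e (vert-q a))) (w≢κ a ∘ sym) (w≢κ c ∘ sym)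

      region-around : ∀ {i w s t} → Free w → vert s ≡ w → vert t ≡ w → Region i s → Region i t
      region-around free s∈w t∈w in-i a c =
        trans (F.color-around a c (free-off free a c) s∈w t∈w) (in-i a c)

      region-α : ∀ {i s} → Free (vert s) → Region i s → Region i (α s)
      region-α {s = s} free in-i a c =
        trans (F.color-uncrossed a c (free-off free a c s refl)) (in-i a c)

      dart : Fin n → Fin d
      dart u = proj₁ (vert-surj u)

      vert-dart : ∀ u → vert (dart u) ≡ u
      vert-dart u = proj₂ (vert-surj u)

      -- A brace end strictly inside the region. It is a free vertex, so any dart at it may
      -- represent it.
      Witness : Fin k → Fin (b ℕ.+ b) → Set
      Witness i e = ends e ≢ x × ends e ≢ y × Region i (dart (ends e))

      -- A region without brace ends has no vertices inside, so it consists of the two faces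
      -- x κᵢ κⱼ and y κᵢ κⱼ; a nonfacial triangle through κᵢ κⱼ would then separate x from y.
      module EmptyRegion (4≤k : 4 ≤ k) (i : Fin k) (¬witness : ¬ ∃ (Witness i)) where

        no-end : ∀ {u s} → BraceEnd u → u ≢ x → u ≢ y → vert s ≡ u → ¬ Region i s
        no-end {u} end u≢x u≢y s∈u in-i with braceEnd-index end
        ... | e , refl = ¬witness (e , u≢x , u≢y ,
          region-around (u≢x , u≢y , λ j eq → κ-¬end j (subst BraceEnd (sym eq) end)) s∈u (vert-dart u) in-i)

        end-of-neighbour : ∀ {w s} → Free w → vert s ≡ w → Region i s →
          ∀ {u} → BraceEnd u → Adj P w u → u ≡ x ⊎ u ≡ y
        end-of-neighbour free s∈w in-i {u} end (z , refl , z↦u) with u Fin.≟ x | u Fin.≟ y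
        ... | yes u≡x | _       = inj₁ u≡x
        ... | no _    | yes u≡y = inj₂ u≡y
        ... | no u≢x  | no u≢y  = contradiction
          (region-α free (region-around free s∈w refl in-i)) (no-end end u≢x u≢y z↦u)

        -- If `w` is not a brace end, it sees a brace. Edges at a free vertex do not leave the
        -- region, which has no brace end inside, so the ends of that brace are `x` and `y`, and `w`
        -- is some `κ l` by `complete`.
        no-free : ∀ {w s} → Free w → vert s ≡ w → ¬ Region i s
        no-free {w} free@(w≢x , w≢y , w≢κ) s∈w in-i with braceEnd? w
        ... | yes end = no-end end w≢x w≢y s∈w in-i
        ... | no ¬end with sees-brace i₀ ¬end
        ... | j , adj₁ , adj₂
          with end-of-neighbour free s∈w in-i (j , inj₁ refl) adj₁
             | end-of-neighbour free s∈w in-i (j , inj₂ refl) adj₂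
        ... | inj₁ e₁ | inj₁ e₂ = brace-ne j (trans e₁ (sym e₂))
        ... | inj₂ e₁ | inj₂ e₂ = brace-ne j (trans e₁ (sym e₂))
        ... | inj₁ e₁ | inj₂ e₂ =
          let l , κl≡w = complete ¬end (subst (Adj P w) e₁ adj₁ , subst (Adj P w) e₂ adj₂) in w≢κ l κl≡w
        ... | inj₂ e₁ | inj₁ e₂ =
          let l , κl≡w = complete ¬end (subst (Adj P w) e₂ adj₂ , subst (Adj P w) e₁ adj₁) in w≢κ l κl≡w

        free : ∀ {w} → w ≢ x → w ≢ y → ¬ (∃ λ j → κ j ≡ w) → Free w
        free w≢x w≢y ∄ = w≢x , w≢y , λ j e → ∄ (j , e)

        σp∈x : vert (σ (p i)) ≡ x
        σp∈x = trans (vert-σ (p i)) (vert-p i)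

        -- The neighbour of `x` following `κ i` is in the region, hence not free; it is not `y`, as
        -- a brace joins non-adjacent vertices. So it is some `κ j`.
        next : ∃ λ j → p j ≡ σ (p i)
        next with Fin.any? (λ j → κ j Fin.≟ h (σ (p i)))
        ... | yes (j , e) = j , no-multi (p j) (σ (p i)) (trans (vert-p j) (sym σp∈x)) e
        ... | no ∄ = ⊥-elim (no-free free′ refl
          (λ a c → sym (F.color-across a c (free-off free′ a c))))
          where
          free′ : Free (h (σ (p i)))
          free′ = free (λ e → no-loop (σ (p i)) (trans e (sym σp∈x)))
            (λ e → brace-nadj i₀ (σ (p i) , σp∈x , e)) ∄

        j : Fin k
        j = proj₁ next

        pj≡ : p j ≡ σ (p i)
        pj≡ = proj₂ next

        σp≢p : σ (p i) ≢ p i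
        σp≢p e = σσ≢ i₀ (p i) (trans (cong σ e) e)

        i≢j : i ≢ j
        i≢j i≡j = σp≢p (trans (sym pj≡) (cong p (sym i≡j)))

        -- `e` runs from `κ j` to `κ i` on the face of `σ (p i)`; `s` starts at the apex of the face
        -- across `e`, which will turn out to be `y`.
        e s : Fin d
        e = φ P (σ (p i))
        s = φ P (σ e)

        vert-e : vert e ≡ κ j
        vert-e = trans (vert-σ _) (cong h (sym pj≡))

        head-e : h e ≡ κ i
        head-e = head-φσ P (p i)

        vert-s : vert s ≡ h (σ e)
        vert-s = vert-σ _

        head-s : h s ≡ κ i
        head-s = trans (head-φσ P e) head-e

        s-region : Region i s
        s-region a c = trans (F.color-φ a c (σ e)) (trans
          (F.color-σ-uncrossed a c (Q.off-edge a c
            (λ eq → x≢κ j (trans (sym (vert-p a)) (trans (sym eq) vert-e)))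
            (λ eq → y≢κ j (trans (sym (vert-q a)) (trans (sym eq) vert-e)))
            (λ eq → x≢κ i (trans (sym (vert-p a)) (trans (sym eq) head-e)))
            (λ eq → y≢κ i (trans (sym (vert-q a)) (trans (sym eq) head-e)))))
          (F.color-φ a c (σ (p i))))

        -- If the apex were `x`, simplicity would make `κ j` a vertex of degree two.
        s∉x : h (σ e) ≢ x
        s∉x eq = σσ≢ i₀ (α (σ (p i))) (no-multi (σ e) (α (σ (p i)))
          (trans (vert-σ e) (vert-σ _)) (trans eq (trans (sym σp∈x) (sym (head-α P (σ (p i)))))))

        nw : NoWrap P (p i) 0
        nw _ z≤n = σp≢p

        passes-next : Passes P (chain P (Q.quadrilateral i j)) (p i) (σ (p i))
        passes-next = subst (Passes P (chain P (Q.quadrilateral i j)) (p i)) pj≡ (passes i≢j)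

        off-other : ∀ {l} → l ≢ i → l ≢ j → ∀ t → vert t ≡ κ l → chain P (Q.quadrilateral i j) t ≡ 0ℤ
        off-other {l} l≢i l≢j = Q.off-quadrilateral i j
          (λ eq → x≢κ l (trans (sym (vert-p i)) (sym eq)))
          (λ eq → y≢κ l (trans (sym (vert-q i)) (sym eq)))
          (l≢i ∘ κ-injective) (l≢j ∘ κ-injective)

        color-other : ∀ {l} → l ≢ j → F.color i j (p l) ≡ F.color i j (p i)
        color-other {l} l≢j = [ (λ (_ , i≤0 , pl≡) → contradiction (first i≤0 pl≡) l≢j) , id ]′
          (F.sector-or-color≡ i j nw passes-next (p l) (trans (vert-p i) (sym (vert-p l))))
          where
          first : ∀ {m} → m ≤ 0 → p l ≡ iter σ (suc m) (p i) → l ≡ j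
          first z≤n pl≡ = κ-injective (cong h (trans pl≡ (sym pj≡)))

        -- `κ l` is off the 4-cycle of `i` and `j`, and `p l` lies outside the sector from `p i` to
        -- `p j`. So the faces around `κ l` and the face of `s` have different colours.
        s∉other : ∀ {l} → l ≢ i → l ≢ j → κ l ≢ h (σ e)
        s∉other {l} l≢i l≢j eq = F.color-step≢ i j (F.color i j (p i)) (begin
          F.color i j (p i) + F.step i j  ≡⟨ F.color-leave i j (Passes.leaves passes-next) ⟨
          F.color i j (σ (p i))           ≡⟨ s-region i j ⟨
          F.color i j s                   ≡⟨ F.color-around i j off refl (trans vert-s (sym eq)) ⟩
          F.color i j (α (p l))           ≡⟨ F.color-across i j off ⟨
          F.color i j (p l)               ≡⟨ color-other l≢j ⟩
          F.color i j (p i)               ∎)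
          where
          open ≡-Reasoning
          off = off-other l≢i l≢j

        s∉κ : ∀ l → κ l ≢ h (σ e)
        s∉κ l eq with l Fin.≟ i | l Fin.≟ j
        ... | yes refl | _      = no-loop s (trans head-s (trans eq (sym vert-s)))
        ... | no _     | yes l≡j = no-loop (σ e) (trans (sym eq) (trans (cong κ l≡j) (sym (trans (vert-σ e) vert-e))))
        ... | no l≢i   | no l≢j = s∉other l≢i l≢j eq

        s∈y : vert s ≡ y
        s∈y = trans vert-s (decidable-stable (h (σ e) Fin.≟ y)
          (λ s∉y → no-free (s∉x , s∉y , s∉κ) vert-s s-region))

        unbraced : ¬ InBracedTriangle P B (κ j) (κ i)
        unbraced (_ , _ , _ , _ , _ , inj₁ br)        = κ-¬end j (proj₁ (isBrace-ends br))
        unbraced (_ , _ , _ , _ , _ , inj₂ (inj₁ br)) = κ-¬end j (proj₁ (isBrace-ends br))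
        unbraced (_ , _ , _ , _ , _ , inj₂ (inj₂ br)) = κ-¬end i (proj₁ (isBrace-ends br))

        κ-x : ∀ l → Adj P (κ l) x
        κ-x l = adj-sym P (p l , vert-p l , refl)

        κ-y : ∀ l → Adj P (κ l) y
        κ-y l = adj-sym P (q l , vert-q l , same-head l)

        -- The 3-cycle `κ j`, `κ i`, `z` contains the edge `e`, so it separates the face of
        -- `σ (p i)`, at `x`, from the face of `s`, at `y`. The path `x`, `κ l`, `y` avoids the
        -- 3-cycle, so both faces also have the same colour.
        separated : ∀ {z} → z ≢ κ i → x ≢ z → y ≢ z → Adj P (κ j) z → Adj P (κ i) z → ⊥
        separated {z} z≢κi x≢z y≢z (t , vert-t , head-t) (g , vert-g , head-g)
          -- `z` may itself be a value of `κ`, so `l` has to avoid three indices; `4 ≤ k` leaves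
          -- room for it.
          with fourth-index Fin._≟_ κ κ-injective 4≤k i j z
        ... | l , l≢i , l≢j , κl≢z = T.color-step≢ (T.color e) (begin
          T.color e + T.step  ≡⟨ T.color-leave (Passes.leaves T.triangle-passes) ⟨
          T.color (σ e)       ≡⟨ T.color-φ (σ e) ⟨
          T.color s           ≡⟨ T.color-around off-y (vert-q l) s∈y ⟩
          T.color (q l)       ≡⟨ T.color-across (λ u u∈ → off-κ u (trans u∈ (same-head l))) ⟩
          T.color (α (q l))   ≡⟨ T.color-around off-κ refl (same-head l) ⟩
          T.color (α (p l))   ≡⟨ T.color-across off-κ ⟨
          T.color (p l)       ≡⟨ T.color-around off-x σp∈x (vert-p l) ⟩
          T.color (σ (p i))   ≡⟨ T.color-φ (σ (p i)) ⟨
          T.color e           ∎)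
          where
          open ≡-Reasoning
          module T = Triangle P {e} {g} {t} (trans vert-t (sym vert-e)) (trans vert-g (sym head-e))
            (trans head-g (sym head-t)) (λ e≡t → z≢κi (trans (sym head-t) (trans (cong h (sym e≡t)) head-e)))
          off-x : ∀ u → vert u ≡ x → chain P T.triangle u ≡ 0ℤ
          off-x = T.off-triangle (λ eq → x≢κ j (trans eq vert-e)) (λ eq → x≢κ i (trans eq head-e))
            (λ eq → x≢z (trans eq head-t))
          off-y : ∀ u → vert u ≡ y → chain P T.triangle u ≡ 0ℤ
          off-y = T.off-triangle (λ eq → y≢κ j (trans eq vert-e)) (λ eq → y≢κ i (trans eq head-e))
            (λ eq → y≢z (trans eq head-t))
          off-κ : ∀ u → vert u ≡ κ l → chain P T.triangle u ≡ 0ℤ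
          off-κ = T.off-triangle (λ eq → l≢j (κ-injective (trans eq vert-e)))
            (λ eq → l≢i (κ-injective (trans eq head-e))) (λ eq → κl≢z (trans eq head-t))

        impossible : ⊥
        impossible with third-common-neighbour (e , vert-e , head-e) unbraced (brace-ne i₀)
          (common-neighbour (κ-x j) (κ-x i)) (common-neighbour (κ-y j) (κ-y i))
        ... | z , (_ , z≢κi , κj-z , κi-z) , z≢x , z≢y =
          separated z≢κi (z≢x ∘ sym) (z≢y ∘ sym) κj-z κi-z

      witness : 4 ≤ k → ∀ i → ∃ (Witness i)
      witness 4≤k i with Fin.any? (λ e → ¬? (ends e Fin.≟ x) ×-dec ¬? (ends e Fin.≟ y) ×-dec
                                   region? i (dart (ends e)))
      ... | yes found = found
      ... | no ∄ = ⊥-elim (EmptyRegion.impossible 4≤k i ∄)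

      -- Regions are disjoint, so different regions have different witnesses among the `b + b`
      -- indices of brace ends.
      few-common-neighbours : 4 ≤ k → k ≤ b ℕ.+ b
      few-common-neighbours 4≤k = Fin.injective⇒≤ {f = λ i → proj₁ (witness 4≤k i)} λ {i} {j} eq →
        decidable-stable (i Fin.≟ j) λ i≢j → region-disjoint i≢j
          (proj₂ (proj₂ (proj₂ (witness 4≤k i))))
          (subst (λ e → Region j (dart (ends e))) (sym eq) (proj₂ (proj₂ (proj₂ (witness 4≤k j)))))

    -- Counting the vertices

    unbracedNbr? : ∀ i → Decidable (λ w → ¬ BraceEnd w × AdjBoth w i)
    unbracedNbr? i w = ¬? (braceEnd? w) ×-dec adjBoth? w i

    unbracedNbrs : Fin b → List (Fin n)
    unbracedNbrs i = filter (unbracedNbr? i) (allFin n)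

    length-unbracedNbrs : ∀ i → 4 ≤ length (unbracedNbrs i) → length (unbracedNbrs i) ≤ b ℕ.+ b
    length-unbracedNbrs i = few-common-neighbours
      where
      κ : Fin (length (unbracedNbrs i)) → Fin n
      κ = lookup (unbracedNbrs i)
      prop : ∀ j → ¬ BraceEnd (κ j) × AdjBoth (κ j) i
      prop j = proj₂ (∈-filter⁻ (unbracedNbr? i) {xs = allFin n} (∈-lookup j))
      dart-x : ∀ j → Adj P (proj₁ (brace i)) (κ j)
      dart-x j = adj-sym P (proj₁ (proj₂ (prop j)))
      dart-y : ∀ j → Adj P (proj₂ (brace i)) (κ j)
      dart-y j = adj-sym P (proj₂ (proj₂ (prop j)))
      head-x : ∀ j → h (proj₁ (dart-x j)) ≡ κ j
      head-x j = proj₂ (proj₂ (dart-x j))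
      same-head : ∀ j → h (proj₁ (dart-y j)) ≡ h (proj₁ (dart-x j))
      same-head j = trans (proj₂ (proj₂ (dart-y j))) (sym (head-x j))
      κ-injective : ∀ {j l} → h (proj₁ (dart-x j)) ≡ h (proj₁ (dart-x l)) → j ≡ l
      κ-injective {j} {l} eq = lookup-injective (Unique.filter⁺ (unbracedNbr? i) (Unique.allFin⁺ n))
        (trans (sym (head-x j)) (trans eq (head-x l)))
      κ-¬end : ∀ j → ¬ BraceEnd (h (proj₁ (dart-x j)))
      κ-¬end j = proj₁ (prop j) ∘ subst BraceEnd (head-x j)
      complete : ∀ {w} → ¬ BraceEnd w → AdjBoth w i → ∃ λ j → h (proj₁ (dart-x j)) ≡ w
      complete {w} ¬end both = index w∈ , trans (head-x (index w∈)) (sym (lookup-index w∈))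
        where
        w∈ : w ∈ unbracedNbrs i
        w∈ = ∈-filter⁺ (unbracedNbr? i) (∈-allFin w) (¬end , both)
      open CommonNeighbours i (proj₁ ∘ dart-x) (proj₁ ∘ dart-y)
        (proj₁ ∘ proj₂ ∘ dart-x) (proj₁ ∘ proj₂ ∘ dart-y) same-head κ-injective κ-¬end complete

    vertex-bound : ∀ {M} → Fin b → (∀ i → length (unbracedNbrs i) ≤ M) → n ≤ (b ℕ.+ b) ℕ.+ b ℕ.* M
    vertex-bound {M} i₀ ≤M = begin
      n                                                      ≤⟨ covering-length cover covers ⟩
      length cover                                           ≡⟨ List.length-++ (tabulate ends) ⟩
      length (tabulate ends) ℕ.+ length (concat (tabulate unbracedNbrs))
        ≤⟨ ℕ.+-mono-≤ (ℕ.≤-reflexive (List.length-tabulate ends)) (length-concat-tabulate unbracedNbrs ≤M) ⟩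
      (b ℕ.+ b) ℕ.+ b ℕ.* M                                  ∎
      where
      open ℕ.≤-Reasoning
      cover : List (Fin n)
      cover = tabulate ends ++ concat (tabulate unbracedNbrs)
      covers : ∀ v → v ∈ cover
      covers v with braceEnd? v
      ... | yes end with braceEnd-index end
      ...   | e , refl = ∈-++⁺ˡ (∈-tabulate⁺ e)
      covers v | no ¬end with sees-brace i₀ ¬end
      ...   | i , both = ∈-++⁺ʳ (tabulate ends)
        (∈-concat⁺′ (∈-filter⁺ (unbracedNbr? i) (∈-allFin v) (¬end , both)) (∈-tabulate⁺ i))

theorem2p5 : (n : ℕ) (P : SphereTriangulation n) (b : ℕ) (B : Braces P b) →
    2 ≤ b → Irreducible P B → n ≤ 4 ℕ.* (b ℕ.* b) ∸ 2 ℕ.* b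
theorem2p5 n P (suc (suc c)) B (s≤s (s≤s z≤n)) irr = begin
  n                                        ≤⟨ vertex-bound P B irr zero few ⟩
  -- Adding and removing `2 * b` avoids truncated subtraction and leaves the semiring identity
  -- `total`.
  X                                        ≡⟨ ℕ.m+n∸n≡m X (2 ℕ.* b) ⟨
  X ℕ.+ 2 ℕ.* b ℕ.∸ 2 ℕ.* b                ≡⟨ cong (ℕ._∸ 2 ℕ.* b) (total c) ⟩
  4 ℕ.* (b ℕ.* b) ℕ.∸ 2 ℕ.* b              ∎
  where
  open ℕ.≤-Reasoning
  b M X : ℕ
  b = suc (suc c)
  -- This is `4 b - 4`, which for `b ≥ 2` is at least `2 b` and at least 4, hence bounds both cases
  -- of `few`.
  M = 4 ℕ.* suc c
  X = (b ℕ.+ b) ℕ.+ b ℕ.* M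
  total : ∀ c → let b = suc (suc c) in
    (b ℕ.+ b) ℕ.+ b ℕ.* (4 ℕ.* suc c) ℕ.+ 2 ℕ.* b ≡ 4 ℕ.* (b ℕ.* b)
  total = ℕSolver.solve-∀
  slack : ∀ c → 4 ℕ.* suc c ≡ (suc (suc c) ℕ.+ suc (suc c)) ℕ.+ 2 ℕ.* c
  slack = ℕSolver.solve-∀
  few : ∀ i → length (unbracedNbrs P B irr i) ≤ M
  few i with 4 ℕ.≤? length (unbracedNbrs P B irr i)
  ... | yes 4≤ = ℕ.≤-trans (length-unbracedNbrs P B irr i 4≤)
                   (subst (b ℕ.+ b ℕ.≤_) (sym (slack c)) (ℕ.m≤m+n (b ℕ.+ b) (2 ℕ.* c)))
  ... | no 4≰  = ℕ.≤-trans (ℕ.<⇒≤ (ℕ.≰⇒> 4≰)) (ℕ.*-monoʳ-≤ 4 (s≤s (z≤n {c})))
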